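{- Let $n,q$ be positive integers with $n\ge6$, $q\ge2$. Any $5$-design $C$ in $H(n,q)$ with degree $3$ and degree set $\{a,n-a,n\}$ for some integer $a$ with $a<n/2$ is isomorphic to the dual of the binary repetition code of length $6$ (i.e., the set of all binary vectors of length $6$ of even weight).
   Context: $[q]=\{1,\ldots,q\}$; $\partial$ is Hamming distance. A nonempty $C\subseteq[q]^n$ is a $t$-design in the Hamming scheme $H(n,q)$ if the array of its elements (as rows) is an orthogonal array of strength $t$: in any $t$ columns every element of $[q]^t$ occurs equally often. Its degree set is $\{\partial(x,y):x,y\in C,x\ne y\}$ and its degree is the size of that set. Two codes are isomorphic if one is obtained from the other by permuting coordinates and permuting symbols within each coordinate. -}

module Defs where

open import Data.Nat using (ℕ)
open import Data.Nat.Divisibility using (_∣_)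
open import Data.Fin using (Fin; zero; suc)
open import Data.Fin.Properties using () renaming (_≟_ to _≟F_)
open import Data.Vec using (Vec; lookup; tabulate)
open import Data.Vec.Properties using (≡-dec)
open import Data.List using (List; length; filter; allFin)
open import Data.List.Membership.Propositional using (_∈_)
open import Data.List.Relation.Unary.Unique.Propositional using (Unique)
open import Data.Product using (Σ; ∃; _×_; _,_)
open import Data.Sum using (_⊎_)
open import Function using (_∘_)
open import Function.Bundles using (_↔_; Inverse)
open import Relation.Binary.PropositionalEquality using (_≡_; _≢_)
open import Relation.Nullary using (¬?)

Word : ℕ → ℕ → Set
Word n q = Vec (Fin q) n

record Code (n q : ℕ) : Set where
  constructor mkCode
  field
    words  : List (Word n q)
    unique : Unique words
open Code public

hamming : ∀ {n q} → Word n q → Word n q → ℕ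
hamming {n} x y = length (filter (λ i → ¬? (lookup x i ≟F lookup y i)) (allFin n))

restrict : ∀ {n q t} → (Fin t → Fin n) → Word n q → Vec (Fin q) t
restrict cols x = tabulate (λ j → lookup x (cols j))

occurrences : ∀ {n q t} → Code n q → (Fin t → Fin n) → Vec (Fin q) t → ℕ
occurrences C cols u = length (filter (λ x → ≡-dec _≟F_ (restrict cols x) u) (words C))

Injective : ∀ {a b} → (Fin a → Fin b) → Set
Injective f = ∀ i j → f i ≡ f j → i ≡ j

IsDesign : ∀ {n q} → ℕ → Code n q → Set
IsDesign t C = ∀ (cols : Fin t → Fin _) → Injective cols →
  ∀ (u v : Vec (Fin _) t) → occurrences C cols u ≡ occurrences C cols v

InDegreeSet : ∀ {n q} → Code n q → ℕ → Set
InDegreeSet C d = Σ _ λ x → Σ _ λ y → x ∈ words C × y ∈ words C × x ≢ y × hamming x y ≡ d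

IsomorphicTo : ∀ {n q n' q'} → Code n q → (Word n' q' → Set) → Set
IsomorphicTo {n} {q} {n'} {q'} C D =
  Σ (Fin n' ↔ Fin n) λ σ → Σ ((i : Fin n') → Fin q ↔ Fin q') λ π →
    ∀ (y : Word n' q') →
      (D y → Σ (Word n q) λ x → x ∈ words C ×
                tabulate (λ i → Inverse.to (π i) (lookup x (Inverse.to σ i))) ≡ y)
    × ((Σ (Word n q) λ x → x ∈ words C ×
                tabulate (λ i → Inverse.to (π i) (lookup x (Inverse.to σ i))) ≡ y) → D y)

weight : ∀ {n} → Word n 2 → ℕ
weight {n} x = length (filter (λ i → ¬? (lookup x i ≟F zero)) (allFin n))

EvenWeight6 : Word 6 2 → Set
EvenWeight6 x = 2 ∣ weight x

{-# OPTIONS --safe #-}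

-- Fix x in C and let a, b = n − a be the two possible nonzero numbers of agreements of x with
-- another codeword. Among the codewords z that agree with x in column i and have a prescribed
-- wrong symbol in column j, the number W of agreements outside {i, j} takes only the values
-- a − 1 and b − 1, while by strength 5 its first three moments are binomial with parameters
-- M = n − 2 and 1/q. Summing (W − a + 1)(W − b + 1) and its product with W gives q = 2 and
-- M = e², where e = b − a. The codewords agreeing with x in one column give in the same way
-- |C| = M² + 3M + 4. Finally, for codewords x, y with b agreements, i and j among them, the sum
-- over the same z of the product of the numbers of agreements with x and with y is known both
-- exactly and modulo e²; hence e² divides 4(e − 2), so e = 2 and n = 6. All distances are then
-- even, and strength 5 forces every word of the right parity to occur.

module Submission where

open import Defs
open import Data.Nat using (ℕ; zero; suc; pred; _+_; _*_; _^_; _∸_; _≤_; _<_; z≤n; s≤s)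
open import Data.Nat using (NonZero; ≢-nonZero⁻¹; >-nonZero)
open import Data.Nat.Divisibility using (_∣_; divides; ∣⇒≤; ∣m+n∣m⇒∣n; m∣m*n; _∣0)
open import Data.Nat.ListAction using (sum)
open import Data.Nat.Properties
open import Data.Nat.Tactic.RingSolver using (solve-∀)
open import Data.Fin using (Fin; zero; suc)
open import Data.Fin.Patterns using (0F; 1F; 2F; 3F; 4F; 5F)
open import Data.Fin.Properties using () renaming (_≟_ to _≟F_)
open import Data.Vec using (Vec; []; _∷_; lookup; tabulate)
open import Data.Vec.Properties using (≡-dec; lookup∘tabulate; tabulate-cong; tabulate∘lookup)
open import Data.List using (List; []; _∷_; map; length; filter; allFin)
open import Data.List.Properties using (length-tabulate)
open import Data.List.Membership.Propositional using (_∈_)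
open import Data.List.Membership.Propositional.Properties using (∈-allFin)
open import Data.List.Relation.Unary.All using () renaming (lookup to All-lookup)
open import Data.List.Relation.Unary.AllPairs using (_∷_)
open import Data.List.Relation.Unary.Any using (here; there)
open import Data.List.Relation.Unary.Unique.Propositional using (Unique)
open import Data.List.Relation.Unary.Unique.Propositional.Properties using (allFin⁺)
open import Data.Product using (Σ; ∃; _×_; _,_; proj₁; proj₂)
open import Data.Sum using (_⊎_; inj₁; inj₂)
open import Data.Unit using (⊤; tt)
open import Function.Bundles using (_⇔_; _↔_; mk↔ₛ′; Equivalence)
open import Function.Construct.Identity using (↔-id)
open import Relation.Binary.PropositionalEquality
open import Relation.Nullary using (Dec; yes; no; ¬_; ¬?; contradiction)

open ≡-Reasoning

private
  variable
    A B : Set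

-- Finite sums over lists

∑ : List A → (A → ℕ) → ℕ
∑ xs f = sum (map f xs)

∑-cong : (xs : List A) {f g : A → ℕ} → (∀ x → x ∈ xs → f x ≡ g x) → ∑ xs f ≡ ∑ xs g
∑-cong []       h = refl
∑-cong (x ∷ xs) h = cong₂ _+_ (h x (here refl)) (∑-cong xs (λ y y∈ → h y (there y∈)))

∑-+ : (xs : List A) (f g : A → ℕ) → ∑ xs (λ x → f x + g x) ≡ ∑ xs f + ∑ xs g
∑-+ []       f g = refl
∑-+ (x ∷ xs) f g = trans (cong (f x + g x +_) (∑-+ xs f g)) (rearrange (f x) (g x) _ _)
  where
  rearrange : ∀ a b c d → a + b + (c + d) ≡ a + c + (b + d)
  rearrange = solve-∀

∑-*ˡ : (xs : List A) (k : ℕ) (f : A → ℕ) → ∑ xs (λ x → k * f x) ≡ k * ∑ xs f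
∑-*ˡ []       k f = sym (*-zeroʳ k)
∑-*ˡ (x ∷ xs) k f = trans (cong (k * f x +_) (∑-*ˡ xs k f)) (sym (*-distribˡ-+ k (f x) _))

∑-*ʳ : (xs : List A) (k : ℕ) (f : A → ℕ) → ∑ xs (λ x → f x * k) ≡ ∑ xs f * k
∑-*ʳ xs k f = trans (∑-cong xs (λ x _ → *-comm (f x) k)) (trans (∑-*ˡ xs k f) (*-comm k _))

∑-const : (xs : List A) (k : ℕ) → ∑ xs (λ _ → k) ≡ length xs * k
∑-const []       k = refl
∑-const (x ∷ xs) k = cong (k +_) (∑-const xs k)

∑-zero : (xs : List A) {f : A → ℕ} → (∀ x → x ∈ xs → f x ≡ 0) → ∑ xs f ≡ 0
∑-zero xs h = trans (∑-cong xs h) (trans (∑-const xs 0) (*-zeroʳ (length xs)))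

∑-swap : (xs : List A) (ys : List B) (f : A → B → ℕ) →
  ∑ xs (λ x → ∑ ys (f x)) ≡ ∑ ys (λ y → ∑ xs (λ x → f x y))
∑-swap []       ys f = sym (∑-zero ys (λ _ _ → refl))
∑-swap (x ∷ xs) ys f = trans (cong (∑ ys (f x) +_) (∑-swap xs ys f)) (sym (∑-+ ys (f x) _))

∑-single : {xs : List A} {x : A} {f : A → ℕ} → Unique xs → x ∈ xs →
  (∀ y → y ∈ xs → y ≢ x → f y ≡ 0) → ∑ xs f ≡ f x
∑-single {xs = z ∷ xs} {f = f} (z∉ ∷ u) (here refl) h =
  trans (cong (f z +_) (∑-zero xs (λ y y∈ → h y (there y∈) (λ { refl → All-lookup z∉ y∈ refl }))))
        (+-identityʳ (f z))
∑-single {xs = z ∷ xs} (z∉ ∷ u) (there x∈) h =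
  cong₂ _+_ (h z (here refl) (All-lookup z∉ x∈)) (∑-single u x∈ (λ y y∈ → h y (there y∈)))

∑-positive : (xs : List A) (f : A → ℕ) → 0 < ∑ xs f → ∃ λ x → x ∈ xs × 0 < f x
∑-positive (x ∷ xs) f p with f x in eq
... | suc _ = x , here refl , subst (0 <_) (sym eq) (s≤s z≤n)
... | zero with y , y∈ , q ← ∑-positive xs f p = y , there y∈ , q

-- Indicators and Kronecker deltas

⟦_⟧ : {P : Set} → Dec P → ℕ
⟦ yes _ ⟧ = 1
⟦ no _ ⟧  = 0

⟦⟧-cong : {P Q : Set} (p : Dec P) (q : Dec Q) → (P → Q) → (Q → P) → ⟦ p ⟧ ≡ ⟦ q ⟧
⟦⟧-cong (yes p) (yes q) f g = refl
⟦⟧-cong (yes p) (no ¬q) f g = contradiction (f p) ¬q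
⟦⟧-cong (no ¬p) (yes q) f g = contradiction (g q) ¬p
⟦⟧-cong (no ¬p) (no ¬q) f g = refl

length-filter-∑ : {P : A → Set} (P? : (x : A) → Dec (P x)) (xs : List A) →
  length (filter P? xs) ≡ ∑ xs (λ x → ⟦ P? x ⟧)
length-filter-∑ P? []       = refl
length-filter-∑ P? (x ∷ xs) with P? x
... | yes _ = cong suc (length-filter-∑ P? xs)
... | no _  = length-filter-∑ P? xs

length-allFin : ∀ n → length (allFin n) ≡ n
length-allFin n = length-tabulate {n = n} (λ i → i)

∑-Fin-const : ∀ n k → ∑ (allFin n) (λ _ → k) ≡ n * k
∑-Fin-const n k = trans (∑-const (allFin n) k) (cong (_* k) (length-allFin n))

δ : ∀ {n} → Fin n → Fin n → ℕ
δ i j = ⟦ i ≟F j ⟧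

δ̄ : ∀ {n} → Fin n → Fin n → ℕ
δ̄ i j = ⟦ ¬? (i ≟F j) ⟧

δ-≡ : ∀ {n} {i j : Fin n} → i ≡ j → δ i j ≡ 1
δ-≡ {i = i} {j} p with i ≟F j
... | yes _ = refl
... | no ¬p = contradiction p ¬p

δ-≢ : ∀ {n} {i j : Fin n} → i ≢ j → δ i j ≡ 0
δ-≢ {i = i} {j} ¬p with i ≟F j
... | yes p = contradiction p ¬p
... | no _ = refl

δ-sym : ∀ {n} (i j : Fin n) → δ i j ≡ δ j i
δ-sym i j = ⟦⟧-cong (i ≟F j) (j ≟F i) sym sym

δ+δ̄ : ∀ {n} (i j : Fin n) → δ i j + δ̄ i j ≡ 1
δ+δ̄ i j with i ≟F j
... | yes _ = refl
... | no _ = refl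

∑-δ : ∀ {n} (i : Fin n) (f : Fin n → ℕ) → ∑ (allFin n) (λ j → δ i j * f j) ≡ f i
∑-δ {n} i f = trans (∑-single (allFin⁺ n) (∈-allFin i)
    (λ j _ j≢i → cong (_* f j) (δ-≢ (λ i≡j → j≢i (sym i≡j)))))
  (trans (cong (_* f i) (δ-≡ {i = i} refl)) (*-identityˡ (f i)))

∑-remove : ∀ {n} (i : Fin n) (f : Fin n → ℕ) →
  ∑ (allFin n) f ≡ f i + ∑ (allFin n) (λ j → δ̄ i j * f j)
∑-remove {n} i f = begin
  ∑ (allFin n) f
    ≡⟨ ∑-cong (allFin n) (λ j _ → sym (trans (sym (*-distribʳ-+ (f j) (δ i j) (δ̄ i j)))
         (trans (cong (_* f j) (δ+δ̄ i j)) (*-identityˡ (f j))))) ⟩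
  ∑ (allFin n) (λ j → δ i j * f j + δ̄ i j * f j)
    ≡⟨ ∑-+ (allFin n) _ _ ⟩
  ∑ (allFin n) (λ j → δ i j * f j) + ∑ (allFin n) (λ j → δ̄ i j * f j)
    ≡⟨ cong (_+ ∑ (allFin n) (λ j → δ̄ i j * f j)) (∑-δ i f) ⟩
  f i + ∑ (allFin n) (λ j → δ̄ i j * f j) ∎

-- Words with prescribed symbols and agreements outside the prescribed columns

-- Kept as a product of deltas, so that prescribing one more symbol multiplies the weight by one
-- factor; `count-split` and `mark` rest on this.
χ : ∀ {n q k} → Vec (Fin n) k → Vec (Fin q) k → Word n q → ℕ
χ []       []       z = 1
χ (c ∷ cs) (v ∷ vs) z = δ (lookup z c) v * χ cs vs z

-- A 0/1 weight instead of a sublist: sums over the columns outside `cs` then still run over all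
-- columns.
new : ∀ {n k} → Vec (Fin n) k → Fin n → ℕ
new []       l = 1
new (c ∷ cs) l = δ̄ c l * new cs l

Distinct : ∀ {n k} → Vec (Fin n) k → Set
Distinct []       = ⊤
Distinct (c ∷ cs) = new cs c ≡ 1 × Distinct cs

agr : ∀ {n q k} → Word n q → Vec (Fin n) k → Word n q → ℕ
agr {n} x cs z = ∑ (allFin n) (λ l → new cs l * δ (lookup z l) (lookup x l))

new-0∨1 : ∀ {n k} (cs : Vec (Fin n) k) l → new cs l ≡ 0 ⊎ new cs l ≡ 1
new-0∨1 []       l = inj₂ refl
new-0∨1 (c ∷ cs) l with c ≟F l
... | yes _ = inj₁ refl
... | no _  = subst (λ m → m ≡ 0 ⊎ m ≡ 1) (sym (+-identityʳ _)) (new-0∨1 cs l)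

new-cong : ∀ {n k} (cs : Vec (Fin n) k) l {a b : ℕ} → (new cs l ≡ 1 → a ≡ b) → new cs l * a ≡ new cs l * b
new-cong cs l h with new-0∨1 cs l
... | inj₁ e rewrite e = refl
... | inj₂ e rewrite e = cong (_+ 0) (h refl)

new⇒≢ : ∀ {n k} (cs : Vec (Fin n) k) l → new cs l ≡ 1 → ∀ i → lookup cs i ≢ l
new⇒≢ (c ∷ cs) l h i eq with c ≟F l
new⇒≢ (c ∷ cs) l () i eq | yes _
new⇒≢ (c ∷ cs) l h zero eq | no ¬p = ¬p eq
new⇒≢ (c ∷ cs) l h (suc i) eq | no ¬p = new⇒≢ cs l (trans (sym (+-identityʳ _)) h) i eq

Distinct⇒Injective : ∀ {n k} (cs : Vec (Fin n) k) → Distinct cs → Injective (lookup cs)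
Distinct⇒Injective (c ∷ cs) (h , d) zero zero eq = refl
Distinct⇒Injective (c ∷ cs) (h , d) zero (suc j) eq = contradiction (sym eq) (new⇒≢ cs c h j)
Distinct⇒Injective (c ∷ cs) (h , d) (suc i) zero eq = contradiction eq (new⇒≢ cs c h i)
Distinct⇒Injective (c ∷ cs) (h , d) (suc i) (suc j) eq = cong suc (Distinct⇒Injective cs d i j eq)

∑-new-remove : ∀ {n k} (cs : Vec (Fin n) k) c → new cs c ≡ 1 → (f : Fin n → ℕ) →
  ∑ (allFin n) (λ l → new cs l * f l) ≡ f c + ∑ (allFin n) (λ l → new (c ∷ cs) l * f l)
∑-new-remove {n} cs c h f = trans (∑-remove c (λ l → new cs l * f l))
  (cong₂ _+_ (trans (cong (_* f c) h) (*-identityˡ (f c)))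
             (∑-cong (allFin n) (λ l _ → sym (*-assoc (δ̄ c l) (new cs l) (f l)))))

∑-new : ∀ {n k} (cs : Vec (Fin n) k) → Distinct cs → k + ∑ (allFin n) (λ l → new cs l * 1) ≡ n
∑-new {n} [] d = trans (∑-Fin-const n 1) (*-identityʳ n)
∑-new {n} {suc k} (c ∷ cs) (h , d) = trans (sym (+-suc k _))
  (trans (cong (k +_) (sym (∑-new-remove cs c h (λ _ → 1)))) (∑-new cs d))

agr-remove : ∀ {n q k} (x : Word n q) (cs : Vec (Fin n) k) c z → new cs c ≡ 1 →
  agr x cs z ≡ δ (lookup z c) (lookup x c) + agr x (c ∷ cs) z
agr-remove x cs c z h = ∑-new-remove cs c h (λ l → δ (lookup z l) (lookup x l))

agr-sym : ∀ {n q k} (x : Word n q) (cs : Vec (Fin n) k) z → agr x cs z ≡ agr z cs x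
agr-sym {n} x cs z = ∑-cong (allFin n) (λ l _ → cong (new cs l *_) (δ-sym (lookup z l) (lookup x l)))

agr-self : ∀ {n q k} (x : Word n q) (cs : Vec (Fin n) k) → Distinct cs → k + agr x cs x ≡ n
agr-self {n} {k = k} x cs d = trans
  (cong (k +_) (∑-cong (allFin n) (λ l _ → cong (new cs l *_) (δ-≡ {i = lookup x l} refl))))
  (∑-new cs d)

hamming+agr : ∀ {n q} (x z : Word n q) → hamming x z + agr x [] z ≡ n
hamming+agr {n} x z = begin
  hamming x z + agr x [] z
    ≡⟨ cong₂ _+_ (length-filter-∑ _ (allFin n)) (agr-sym x [] z) ⟩
  ∑ (allFin n) (λ l → δ̄ (lookup x l) (lookup z l)) + agr z [] x
    ≡⟨ ∑-+ (allFin n) _ _ ⟨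
  ∑ (allFin n) (λ l → δ̄ (lookup x l) (lookup z l) + (δ (lookup x l) (lookup z l) + 0))
    ≡⟨ ∑-cong (allFin n) (λ l _ → trans (cong (δ̄ (lookup x l) (lookup z l) +_) (+-identityʳ _))
         (trans (+-comm (δ̄ (lookup x l) (lookup z l)) _) (δ+δ̄ (lookup x l) (lookup z l)))) ⟩
  ∑ (allFin n) (λ _ → 1)
    ≡⟨ trans (∑-Fin-const n 1) (*-identityʳ n) ⟩
  n ∎

-- A word of weight 0 contributes nothing, so inside a sum weighted by `χ` the prescribed symbols
-- may be assumed when a summand is rewritten.
χ-cong : ∀ {n q k} (cs : Vec (Fin n) k) (vs : Vec (Fin q) k) z {a b : ℕ} →
  ((∀ i → lookup z (lookup cs i) ≡ lookup vs i) → a ≡ b) → χ cs vs z * a ≡ χ cs vs z * b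
χ-cong [] [] z h = cong (_+ 0) (h (λ ()))
χ-cong (c ∷ cs) (v ∷ vs) z {a} {b} h with lookup z c ≟F v
... | no _ = refl
... | yes p = trans (cong (_* a) (+-identityʳ (χ cs vs z))) (trans
    (χ-cong cs vs z (λ g → h (λ { zero → p ; (suc i) → g i })))
    (cong (_* b) (sym (+-identityʳ (χ cs vs z)))))

χ-positive : ∀ {n q k} (cs : Vec (Fin n) k) (vs : Vec (Fin q) k) z → 0 < χ cs vs z →
  ∀ i → lookup z (lookup cs i) ≡ lookup vs i
χ-positive (c ∷ cs) (v ∷ vs) z pos i with lookup z c ≟F v
χ-positive (c ∷ cs) (v ∷ vs) z ()  i       | no _
χ-positive (c ∷ cs) (v ∷ vs) z pos zero    | yes p = p
χ-positive (c ∷ cs) (v ∷ vs) z pos (suc i) | yes _ =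
  χ-positive cs vs z (subst (0 <_) (+-identityʳ (χ cs vs z)) pos) i

χ≡⟦⟧ : ∀ {n q k} (cs : Vec (Fin n) k) (vs : Vec (Fin q) k) z →
  χ cs vs z ≡ ⟦ ≡-dec _≟F_ (restrict (lookup cs) z) vs ⟧
χ≡⟦⟧ [] [] z = refl
χ≡⟦⟧ (c ∷ cs) (v ∷ vs) z rewrite χ≡⟦⟧ cs vs z
  with lookup z c ≟F v | ≡-dec _≟F_ (restrict (lookup cs) z) vs
... | yes _ | yes _ = refl
... | yes _ | no _ = refl
... | no _ | yes _ = refl
... | no _ | no _ = refl

-- Counts and factorial moments in a 5-design

-- The falling factorial; truncation by `pred` is harmless, since a factor 0 has then already
-- appeared. Applied to a number of agreements it counts ordered r-tuples of distinct agreeing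
-- columns.
falling : ℕ → ℕ → ℕ
falling m zero    = 1
falling m (suc r) = m * falling (pred m) r

module Design {n q} (C : Code n q) (design : IsDesign 5 C) (6≤n : 6 ≤ n) where

  count : ∀ {k} → Vec (Fin n) k → Vec (Fin q) k → ℕ
  count cs vs = ∑ (words C) (χ cs vs)

  N : ℕ
  N = length (words C)

  count≡occurrences : ∀ {k} (cs : Vec (Fin n) k) vs → count cs vs ≡ occurrences C (lookup cs) vs
  count≡occurrences cs vs = trans (∑-cong (words C) (λ z _ → χ≡⟦⟧ cs vs z))
    (sym (length-filter-∑ (λ x → ≡-dec _≟F_ (restrict (lookup cs) x) vs) (words C)))

  -- Since n is at least 6, five columns or fewer never exhaust all of them.
  fresh : ∀ {k} (cs : Vec (Fin n) k) → k ≤ 5 → Distinct cs → ∃ λ c → new cs c ≡ 1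
  fresh {k} cs k≤5 d with ∑-positive (allFin n) (λ l → new cs l * 1) pos
    where
    pos : 0 < ∑ (allFin n) (λ l → new cs l * 1)
    pos = n≢0⇒n>0 (λ e → <⇒≢ (≤-trans (s≤s k≤5) 6≤n)
      (trans (sym (+-identityʳ k)) (trans (cong (k +_) (sym e)) (∑-new cs d))))
  ... | c , _ , p with new-0∨1 cs c
  ...   | inj₁ e = contradiction (subst (λ m → 0 < m * 1) e p) λ ()
  ...   | inj₂ e = c , e

  count-split : ∀ {k} (cs : Vec (Fin n) k) vs c → count cs vs ≡ ∑ (allFin q) (λ v → count (c ∷ cs) (v ∷ vs))
  count-split cs vs c = begin
    ∑ (words C) (χ cs vs)
      ≡⟨ ∑-cong (words C) (λ z _ → ∑-δ (lookup z c) (λ _ → χ cs vs z)) ⟨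
    ∑ (words C) (λ z → ∑ (allFin q) (λ v → δ (lookup z c) v * χ cs vs z))
      ≡⟨ ∑-swap (words C) (allFin q) _ ⟩
    ∑ (allFin q) (λ v → count (c ∷ cs) (v ∷ vs)) ∎

  -- Descent from strength 5: for fewer than five columns, add a fresh one and sum over its symbols.
  -- The number `d` of columns still missing drives the recursion.
  count-indep : ∀ d {k} → d + k ≡ 5 → (cs : Vec (Fin n) k) → Distinct cs →
    ∀ us vs → count cs us ≡ count cs vs
  count-indep zero refl cs dist us vs = trans (count≡occurrences cs us)
    (trans (design (lookup cs) (Distinct⇒Injective cs dist) us vs) (sym (count≡occurrences cs vs)))
  count-indep (suc d) {k} eq cs dist us vs
    with c , h ← fresh cs (subst (k ≤_) eq (m≤n+m k (suc d))) dist = begin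
    count cs us
      ≡⟨ count-split cs us c ⟩
    ∑ (allFin q) (λ v → count (c ∷ cs) (v ∷ us))
      ≡⟨ ∑-cong (allFin q) (λ v _ → count-indep d (trans (+-suc d k) eq) (c ∷ cs) (h , dist) (v ∷ us) (v ∷ vs)) ⟩
    ∑ (allFin q) (λ v → count (c ∷ cs) (v ∷ vs))
      ≡⟨ count-split cs vs c ⟨
    count cs vs ∎

  -- Each new column splits the count into q equal parts by `count-indep`, starting from N for no
  -- columns.
  count-value : ∀ {k} → k ≤ 5 → (cs : Vec (Fin n) k) → Distinct cs → ∀ vs → count cs vs * q ^ k ≡ N
  count-value k≤5 [] dist [] = trans (*-identityʳ _) (trans (∑-const (words C) 1) (*-identityʳ N))
  count-value {suc k} k≤5 (c ∷ cs) (h , dist) (v ∷ vs) = begin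
    count (c ∷ cs) (v ∷ vs) * (q * q ^ k)
      ≡⟨ rearrange (count (c ∷ cs) (v ∷ vs)) q (q ^ k) ⟩
    q * count (c ∷ cs) (v ∷ vs) * q ^ k
      ≡⟨ cong (_* q ^ k) (∑-Fin-const q _) ⟨
    ∑ (allFin q) (λ _ → count (c ∷ cs) (v ∷ vs)) * q ^ k
      ≡⟨ cong (_* q ^ k) (∑-cong (allFin q) (λ w _ →
           count-indep (5 ∸ suc k) (m∸n+n≡m k≤5) (c ∷ cs) (h , dist) (v ∷ vs) (w ∷ vs))) ⟩
    ∑ (allFin q) (λ w → count (c ∷ cs) (w ∷ vs)) * q ^ k
      ≡⟨ cong (_* q ^ k) (count-split cs vs c) ⟨
    count cs vs * q ^ k
      ≡⟨ count-value (≤-trans (n≤1+n k) k≤5) cs dist vs ⟩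
    N ∎
    where
    rearrange : ∀ a b c → a * (b * c) ≡ b * a * c
    rearrange = solve-∀

  covered : NonZero N → ∀ {k} → k ≤ 5 → (cs : Vec (Fin n) k) → Distinct cs → ∀ vs →
    ∃ λ x → x ∈ words C × (∀ i → lookup x (lookup cs i) ≡ lookup vs i)
  covered N≢0 {k} k≤5 cs dist vs =
    let x , x∈ , pos = ∑-positive (words C) (χ cs vs) (n≢0⇒n>0 count≢0)
    in x , x∈ , χ-positive cs vs x pos
    where
    count≢0 : count cs vs ≢ 0
    count≢0 e = ≢-nonZero⁻¹ N {{N≢0}}
      (trans (sym (count-value k≤5 cs dist vs)) (cong (_* q ^ k) e))

  -- Double counting: pick a column outside `cs` in which z agrees with y. It joins the prescribed
  -- columns, with the symbol that y has there.
  mark : ∀ {k} (cs : Vec (Fin n) k) vs (y : Word n q) (f : Word n q → ℕ) →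
    ∑ (words C) (λ z → χ cs vs z * (agr y cs z * f z)) ≡
    ∑ (allFin n) (λ l → new cs l * ∑ (words C) (λ z → χ (l ∷ cs) (lookup y l ∷ vs) z * f z))
  mark cs vs y f = begin
    ∑ (words C) (λ z → χ cs vs z * (agr y cs z * f z))
      ≡⟨ ∑-cong (words C) (λ z _ → trans (rearrange (χ cs vs z) (agr y cs z) (f z))
           (trans (sym (∑-*ʳ (allFin n) (χ cs vs z * f z) _))
             (∑-cong (allFin n) (λ l _ → rearrange′ (new cs l) _ (χ cs vs z) (f z))))) ⟩
    ∑ (words C) (λ z → ∑ (allFin n) (λ l → new cs l * (χ (l ∷ cs) (lookup y l ∷ vs) z * f z)))
      ≡⟨ ∑-swap (words C) (allFin n) _ ⟩
    ∑ (allFin n) (λ l → ∑ (words C) (λ z → new cs l * (χ (l ∷ cs) (lookup y l ∷ vs) z * f z)))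
      ≡⟨ ∑-cong (allFin n) (λ l _ → ∑-*ˡ (words C) (new cs l) _) ⟩
    ∑ (allFin n) (λ l → new cs l * ∑ (words C) (λ z → χ (l ∷ cs) (lookup y l ∷ vs) z * f z)) ∎
    where
    rearrange : ∀ a b c → a * (b * c) ≡ b * (a * c)
    rearrange = solve-∀
    rearrange′ : ∀ a b c d → a * b * (c * d) ≡ a * (b * c * d)
    rearrange′ = solve-∀

  -- Marking r agreeing columns in order turns the r-th factorial moment into a sum of `falling m r`
  -- counts with r + k prescribed columns, each equal to N / q^(r+k) by `count-value`.
  moment : ∀ r {k} (cs : Vec (Fin n) k) vs (x : Word n q) m → Distinct cs → r + k ≤ 5 → k + m ≡ n →
    ∑ (words C) (λ z → χ cs vs z * falling (agr x cs z) r) * q ^ (r + k) ≡ N * falling m r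
  moment zero cs vs x m dist le eq = trans
    (cong (_* _) (∑-cong (words C) (λ z _ → *-identityʳ _)))
    (trans (count-value le cs dist vs) (sym (*-identityʳ N)))
  -- No column left would mean n = k, but here k is at most 4.
  moment (suc r) {k} cs vs x zero dist le eq =
    contradiction (≤-trans (s≤s (≤-trans (m≤n+m k (suc r)) le)) 6≤n)
      (<-irrefl (trans (sym (+-identityʳ k)) eq))
  moment (suc r) {k} cs vs x (suc m) dist le eq = begin
    ∑ (words C) (λ z → χ cs vs z * (agr x cs z * falling (pred (agr x cs z)) r)) * Q
      ≡⟨ cong (_* Q) (mark cs vs x _) ⟩
    ∑ (allFin n) (λ l → new cs l * ∑ (words C) (λ z →
        χ (l ∷ cs) (lookup x l ∷ vs) z * falling (pred (agr x cs z)) r)) * Q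
      ≡⟨ ∑-*ʳ (allFin n) Q _ ⟨
    ∑ (allFin n) (λ l → new cs l * ∑ (words C) (λ z →
        χ (l ∷ cs) (lookup x l ∷ vs) z * falling (pred (agr x cs z)) r) * Q)
      ≡⟨ ∑-cong (allFin n) (λ l _ → trans (*-assoc (new cs l) _ Q) (new-cong cs l (step l))) ⟩
    ∑ (allFin n) (λ l → new cs l * (N * falling m r))
      ≡⟨ ∑-cong (allFin n) (λ l _ → cong (_* (N * falling m r)) (sym (*-identityʳ (new cs l)))) ⟩
    ∑ (allFin n) (λ l → new cs l * 1 * (N * falling m r))
      ≡⟨ ∑-*ʳ (allFin n) (N * falling m r) (λ l → new cs l * 1) ⟩
    ∑ (allFin n) (λ l → new cs l * 1) * (N * falling m r)
      ≡⟨ cong (_* (N * falling m r)) (+-cancelˡ-≡ k _ _ (trans (∑-new cs dist) (sym eq))) ⟩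
    suc m * (N * falling m r)
      ≡⟨ rearrange (suc m) N (falling m r) ⟩
    N * (suc m * falling m r) ∎
    where
    Q : ℕ
    Q = q ^ (suc r + k)
    rearrange : ∀ a b c → a * (b * c) ≡ b * (a * c)
    rearrange = solve-∀
    -- With the symbol of x prescribed in column l, the agreement there is the one that `pred`
    -- removes.
    step : ∀ l → new cs l ≡ 1 →
      ∑ (words C) (λ z → χ (l ∷ cs) (lookup x l ∷ vs) z * falling (pred (agr x cs z)) r) * Q
        ≡ N * falling m r
    step l h = trans
      (cong₂ _*_
        (∑-cong (words C) (λ z _ → χ-cong (l ∷ cs) (lookup x l ∷ vs) z (λ g →
          cong (λ w → falling (pred w) r)
            (trans (agr-remove x cs l z h) (cong (_+ agr x (l ∷ cs) z) (δ-≡ (g zero)))))))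
        (cong (q ^_) (sym (+-suc r k))))
      (moment r (l ∷ cs) (lookup x l ∷ vs) x m (h , dist)
        (subst (_≤ 5) (sym (+-suc r k)) le) (trans (sym (+-suc k m)) eq))

-- Arithmetic consequences of the moment equations

-- In the next lemmas S₀, S₁, … are factorial moments of the number of agreements,
-- and c = ab, M = a + b for the two possible values a, b of that number. From here on a and b
-- are one less than the a and b of the opening comment.

two-symbols : ∀ N S₀ S₁ S₂ S₃ q c m .{{_ : NonZero N}} → let M = 2 + m in
  S₀ * q ^ 2 ≡ N * falling M 0 → S₁ * q ^ 3 ≡ N * falling M 1 →
  S₂ * q ^ 4 ≡ N * falling M 2 → S₃ * q ^ 5 ≡ N * falling M 3 →
  S₂ + (S₁ + c * S₀) ≡ M * S₁ → S₃ + (3 * S₂ + (S₁ + c * S₁)) ≡ M * (S₂ + S₁) →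
  2 ≤ q → q ≡ 2 × 4 * c + M ≡ M * M
two-symbols N S₀ S₁ S₂ S₃ (suc (suc p)) c m e₀ e₁ e₂ e₃ h₁ h₂ (s≤s (s≤s z≤n)) = q≡2 , M²
  where
  M q : ℕ
  M = 2 + m
  q = 2 + p

  -- `h₁` times q⁴, with the moments inserted and N cancelled; `suc m` is M - 1.
  first : M * suc m + q * M + q * q * c ≡ M * M * q
  first = *-cancelˡ-≡ _ _ N (begin
    N * (M * suc m + q * M + q * q * c)
      ≡⟨ split N M (suc m) q c ⟩
    N * (M * (suc m * 1)) + q * (N * (M * 1)) + q * q * c * (N * 1)
      ≡⟨ cong₂ _+_ (cong₂ _+_ (sym e₂) (cong (q *_) (sym e₁))) (cong (q * q * c *_) (sym e₀)) ⟩
    S₂ * q ^ 4 + q * (S₁ * q ^ 3) + q * q * c * (S₀ * q ^ 2)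
      ≡⟨ collect S₀ S₁ S₂ q c ⟩
    (S₂ + (S₁ + c * S₀)) * q ^ 4
      ≡⟨ cong (_* q ^ 4) h₁ ⟩
    M * S₁ * q ^ 4
      ≡⟨ pull M S₁ q ⟩
    M * q * (S₁ * q ^ 3)
      ≡⟨ cong (M * q *_) e₁ ⟩
    M * q * (N * (M * 1))
      ≡⟨ fold N M q ⟩
    N * (M * M * q) ∎)
    where
    split : ∀ N M P q c → N * (M * P + q * M + q * q * c) ≡ N * (M * (P * 1)) + q * (N * (M * 1)) + q * q * c * (N * 1)
    split = solve-∀
    collect : ∀ S₀ S₁ S₂ q c → S₂ * (q * (q * (q * (q * 1)))) + q * (S₁ * (q * (q * (q * 1)))) + q * q * c * (S₀ * (q * (q * 1))) ≡ (S₂ + (S₁ + c * S₀)) * (q * (q * (q * (q * 1))))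
    collect = solve-∀
    pull : ∀ M S₁ q → M * S₁ * (q * (q * (q * (q * 1)))) ≡ M * q * (S₁ * (q * (q * (q * 1))))
    pull = solve-∀
    fold : ∀ N M q → M * q * (N * (M * 1)) ≡ N * (M * M * q)
    fold = solve-∀

  -- The same for `h₂` times q⁵, where a factor M cancels as well.
  second : suc m * m + 3 * q * suc m + q * q + q * q * c ≡ M * suc m * q + M * (q * q)
  second = *-cancelˡ-≡ _ _ M (*-cancelˡ-≡ _ _ N (begin
    N * (M * (suc m * m + 3 * q * suc m + q * q + q * q * c))
      ≡⟨ split N M (suc m) m q c ⟩
    N * (M * (suc m * (m * 1))) + 3 * q * (N * (M * (suc m * 1))) + (1 + c) * (q * q) * (N * (M * 1))
      ≡⟨ cong₂ _+_ (cong₂ _+_ (sym e₃) (cong (3 * q *_) (sym e₂))) (cong ((1 + c) * (q * q) *_) (sym e₁)) ⟩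
    S₃ * q ^ 5 + 3 * q * (S₂ * q ^ 4) + (1 + c) * (q * q) * (S₁ * q ^ 3)
      ≡⟨ collect S₁ S₂ S₃ q c ⟩
    (S₃ + (3 * S₂ + (S₁ + c * S₁))) * q ^ 5
      ≡⟨ cong (_* q ^ 5) h₂ ⟩
    M * (S₂ + S₁) * q ^ 5
      ≡⟨ pull M S₁ S₂ q ⟩
    M * q * (S₂ * q ^ 4) + M * (q * q) * (S₁ * q ^ 3)
      ≡⟨ cong₂ _+_ (cong (M * q *_) e₂) (cong (M * (q * q) *_) e₁) ⟩
    M * q * (N * (M * (suc m * 1))) + M * (q * q) * (N * (M * 1))
      ≡⟨ fold N M (suc m) q ⟩
    N * (M * (M * suc m * q + M * (q * q))) ∎))
    where
    split : ∀ N M P m q c → N * (M * (P * m + 3 * q * P + q * q + q * q * c)) ≡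
      N * (M * (P * (m * 1))) + 3 * q * (N * (M * (P * 1))) + (1 + c) * (q * q) * (N * (M * 1))
    split = solve-∀
    collect : ∀ S₁ S₂ S₃ q c → S₃ * (q * (q * (q * (q * (q * 1))))) + 3 * q * (S₂ * (q * (q * (q * (q * 1))))) + (1 + c) * (q * q) * (S₁ * (q * (q * (q * 1)))) ≡
      (S₃ + (3 * S₂ + (S₁ + c * S₁))) * (q * (q * (q * (q * (q * 1)))))
    collect = solve-∀
    pull : ∀ M S₁ S₂ q → M * (S₂ + S₁) * (q * (q * (q * (q * (q * 1))))) ≡ M * q * (S₂ * (q * (q * (q * (q * 1))))) + M * (q * q) * (S₁ * (q * (q * (q * 1))))
    pull = solve-∀
    fold : ∀ N M P q → M * q * (N * (M * (P * 1))) + M * (q * q) * (N * (M * 1)) ≡ N * (M * (M * P * q + M * (q * q)))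
    fold = solve-∀

  -- The terms with c cancel between `first` and `second`; dividing by M - 1 leaves (q - 1)(q - 2) =
  -- 0.
  q²+2≡3q : 3 * q ≡ q * q + 2
  q²+2≡3q = *-cancelˡ-≡ _ _ (suc m) (+-cancelʳ-≡ (suc m * m + q * q + q * q * c + M * M * q) _ _ (begin
    suc m * (3 * q) + (suc m * m + q * q + q * q * c + M * M * q)
      ≡⟨ left m q c ⟩
    (suc m * m + 3 * q * suc m + q * q + q * q * c) + M * M * q
      ≡⟨ cong₂ _+_ second (sym first) ⟩
    (M * suc m * q + M * (q * q)) + (M * suc m + q * M + q * q * c)
      ≡⟨ right m q c ⟩
    suc m * (q * q + 2) + (suc m * m + q * q + q * q * c + M * M * q) ∎))
    where
    left : ∀ m q c → suc m * (3 * q) + (suc m * m + q * q + q * q * c + (2 + m) * (2 + m) * q) ≡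
      (suc m * m + 3 * q * suc m + q * q + q * q * c) + (2 + m) * (2 + m) * q
    left = solve-∀
    right : ∀ m q c → ((2 + m) * suc m * q + (2 + m) * (q * q)) + ((2 + m) * suc m + q * (2 + m) + q * q * c) ≡
      suc m * (q * q + 2) + (suc m * m + q * q + q * q * c + (2 + m) * (2 + m) * q)
    right = solve-∀

  -- With q = 2 + p the equation becomes p + p² = 0.
  p≡0 : p ≡ 0
  p≡0 = m+n≡0⇒m≡0 p (sym (+-cancelˡ-≡ (3 * q) 0 (p + p * p)
    (trans (+-identityʳ (3 * q)) (trans q²+2≡3q (expand p)))))
    where
    expand : ∀ p → (2 + p) * (2 + p) + 2 ≡ 3 * (2 + p) + (p + p * p)
    expand = solve-∀

  q≡2 : q ≡ 2
  q≡2 = cong (2 +_) p≡0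

  -- This is `first` at q = 2, with M² added on both sides to avoid subtraction.
  M² : 4 * c + M ≡ M * M
  M² = +-cancelʳ-≡ (M * M) _ _ (begin
    4 * c + M + M * M              ≡⟨ left m c ⟩
    M * suc m + 2 * M + 2 * 2 * c  ≡⟨ subst (λ q → M * suc m + q * M + q * q * c ≡ M * M * q) q≡2 first ⟩
    M * M * 2                      ≡⟨ right M ⟩
    M * M + M * M                  ∎)
    where
    left : ∀ m c → 4 * c + (2 + m) + (2 + m) * (2 + m) ≡ (2 + m) * suc m + 2 * (2 + m) + 2 * 2 * c
    left = solve-∀
    right : ∀ M → M * M * 2 ≡ M * M + M * M
    right = solve-∀

-- Here one column is prescribed, so `suc M` columns enter the moments. The constant `suc M + c` is
-- the excess due to x itself, which is among the counted words.
size-formula : ∀ N S₀ S₁ S₂ c M →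
  S₀ * 2 ^ 1 ≡ N * falling (suc M) 0 → S₁ * 2 ^ 2 ≡ N * falling (suc M) 1 → S₂ * 2 ^ 3 ≡ N * falling (suc M) 2 →
  S₂ + (S₁ + c * S₀) ≡ M * S₁ + (suc M + c) → 4 * c + M ≡ M * M → N ≡ 4 + 3 * M + M * M
size-formula N S₀ S₁ S₂ c M e₀ e₁ e₂ h M² = +-cancelʳ-≡ M _ _ (begin
  N + M                   ≡⟨ cong (_+ M) N≡ ⟩
  4 * (suc M + c) + M     ≡⟨ regroup M c ⟩
  4 * suc M + (4 * c + M) ≡⟨ cong (4 * suc M +_) M² ⟩
  4 * suc M + M * M       ≡⟨ regroup′ M ⟩
  4 + 3 * M + M * M + M   ∎)
  where
  regroup : ∀ M c → 4 * (suc M + c) + M ≡ 4 * suc M + (4 * c + M)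
  regroup = solve-∀
  regroup′ : ∀ M → 4 * suc M + M * M ≡ 4 + 3 * M + M * M + M
  regroup′ = solve-∀
  split : ∀ N M → 2 * N + N * (2 * (M * M) + 3 * M) ≡
    N * (suc M * (M * 1)) + 2 * (N * (suc M * 1)) + N * (M * M)
  split = solve-∀
  expand : ∀ N M c → N * (suc M * (M * 1)) + 2 * (N * (suc M * 1)) + N * (4 * c + M) ≡
    N * (suc M * (M * 1)) + 2 * (N * (suc M * 1)) + 4 * c * (N * 1) + N * M
  expand = solve-∀
  collect : ∀ S₀ S₁ S₂ c X → S₂ * 8 + 2 * (S₁ * 4) + 4 * c * (S₀ * 2) + X ≡ 8 * (S₂ + (S₁ + c * S₀)) + X
  collect = solve-∀
  pull : ∀ S₁ M K X → 8 * (M * S₁ + K) + X ≡ 2 * M * (S₁ * 4) + 8 * K + X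
  pull = solve-∀
  fold : ∀ N M K → 2 * M * (N * (suc M * 1)) + 8 * K + N * M ≡ 2 * (4 * K) + N * (2 * (M * M) + 3 * M)
  fold = solve-∀
  -- Eight times `h` with the moments inserted; after 4c is replaced by M² - M only 2N = 8(M + 1 +
  -- c) survives. The summand N(2M² + 3M) avoids subtraction.
  N≡ : N ≡ 4 * (suc M + c)
  N≡ = *-cancelˡ-≡ _ _ 2 (+-cancelʳ-≡ (N * (2 * (M * M) + 3 * M)) _ _ (begin
    2 * N + N * (2 * (M * M) + 3 * M)
      ≡⟨ split N M ⟩
    N * (suc M * (M * 1)) + 2 * (N * (suc M * 1)) + N * (M * M)
      ≡⟨ cong (λ t → N * (suc M * (M * 1)) + 2 * (N * (suc M * 1)) + N * t) (sym M²) ⟩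
    N * (suc M * (M * 1)) + 2 * (N * (suc M * 1)) + N * (4 * c + M)
      ≡⟨ expand N M c ⟩
    N * (suc M * (M * 1)) + 2 * (N * (suc M * 1)) + 4 * c * (N * 1) + N * M
      ≡⟨ cong (_+ N * M) (cong₂ _+_ (cong₂ _+_ (sym e₂) (cong (2 *_) (sym e₁))) (cong (4 * c *_) (sym e₀))) ⟩
    S₂ * 2 ^ 3 + 2 * (S₁ * 2 ^ 2) + 4 * c * (S₀ * 2 ^ 1) + N * M
      ≡⟨ collect S₀ S₁ S₂ c (N * M) ⟩
    8 * (S₂ + (S₁ + c * S₀)) + N * M
      ≡⟨ cong (λ t → 8 * t + N * M) h ⟩
    8 * (M * S₁ + (suc M + c)) + N * M
      ≡⟨ pull S₁ M (suc M + c) (N * M) ⟩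
    2 * M * (S₁ * 2 ^ 2) + 8 * (suc M + c) + N * M
      ≡⟨ cong (λ t → 2 * M * t + 8 * (suc M + c) + N * M) e₁ ⟩
    2 * M * (N * (suc M * 1)) + 8 * (suc M + c) + N * M
      ≡⟨ fold N M (suc M + c) ⟩
    2 * (4 * (suc M + c)) + N * (2 * (M * M) + 3 * M) ∎))

-- Because (a + b)² - 4ab is the square of the gap e = b - a.
M≡e² : ∀ a e → let M = a + (a + e) in 4 * (a * (a + e)) + M ≡ M * M → M ≡ e * e
M≡e² a e h = +-cancelˡ-≡ (4 * (a * (a + e))) _ _ (trans h (expand a e))
  where
  expand : ∀ a e → (a + (a + e)) * (a + (a + e)) ≡ 4 * (a * (a + e)) + e * e
  expand = solve-∀

-- G and κ come from summing the product of the numbers of agreements with two codewords.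
correlation : ∀ N S₀ S₁ S₁′ G κ a e m w → a + (a + e) ≡ suc m →
  S₀ * 2 ^ 2 ≡ N * falling (suc m) 0 → S₁ * 2 ^ 3 ≡ N * falling (suc m) 1 → S₁′ * 2 ^ 3 ≡ N * falling (suc m) 1 →
  G * 16 ≡ N * (2 * w) + N * (suc m * m) →
  G + a * a * S₀ ≡ a * S₁ + (a * S₁′ + e * e * κ) →
  4 * (a * (a + e)) + suc m ≡ suc m * suc m → N * (2 * w) ≡ 16 * κ * (e * e)
correlation N S₀ S₁ S₁′ G κ a e m w M≡ e₀ e₁ e₁′ eG h M² =
  +-cancelʳ-≡ (N * (4 * (a * suc m))) _ _ (begin
  N * (2 * w) + N * (4 * (a * suc m))
    ≡⟨ cong (λ t → N * (2 * w) + N * (4 * (a * t))) (sym M≡) ⟩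
  N * (2 * w) + N * (4 * (a * (a + (a + e))))
    ≡⟨ expand N w a e ⟩
  N * (2 * w) + N * (4 * (a * (a + e))) + 4 * a * a * (N * 1)
    ≡⟨ cong₂ (λ s t → N * (2 * w) + N * s + 4 * a * a * t) Mm (sym e₀) ⟩
  N * (2 * w) + N * (suc m * m) + 4 * a * a * (S₀ * 2 ^ 2)
    ≡⟨ cong (_+ 4 * a * a * (S₀ * 2 ^ 2)) (sym eG) ⟩
  G * 16 + 4 * a * a * (S₀ * 2 ^ 2)
    ≡⟨ collect G a S₀ ⟩
  16 * (G + a * a * S₀)
    ≡⟨ cong (16 *_) h ⟩
  16 * (a * S₁ + (a * S₁′ + e * e * κ))
    ≡⟨ pull a S₁ S₁′ (e * e) κ ⟩
  16 * κ * (e * e) + 2 * a * (S₁ * 2 ^ 3) + 2 * a * (S₁′ * 2 ^ 3)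
    ≡⟨ cong₂ (λ s t → 16 * κ * (e * e) + 2 * a * s + 2 * a * t) e₁ e₁′ ⟩
  16 * κ * (e * e) + 2 * a * (N * (suc m * 1)) + 2 * a * (N * (suc m * 1))
    ≡⟨ fold (16 * κ * (e * e)) a N (suc m) ⟩
  16 * κ * (e * e) + N * (4 * (a * suc m)) ∎)
  where
  expand : ∀ N w a e → N * (2 * w) + N * (4 * (a * (a + (a + e)))) ≡
    N * (2 * w) + N * (4 * (a * (a + e))) + 4 * a * a * (N * 1)
  expand = solve-∀
  collect : ∀ G a S₀ → G * 16 + 4 * a * a * (S₀ * 4) ≡ 16 * (G + a * a * S₀)
  collect = solve-∀
  pull : ∀ a S₁ S₁′ E κ → 16 * (a * S₁ + (a * S₁′ + E * κ)) ≡ 16 * κ * E + 2 * a * (S₁ * 8) + 2 * a * (S₁′ * 8)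
  pull = solve-∀
  fold : ∀ K a N M → K + 2 * a * (N * (M * 1)) + 2 * a * (N * (M * 1)) ≡ K + N * (4 * (a * M))
  fold = solve-∀
  square : ∀ m → suc m * suc m ≡ suc m * m + suc m
  square = solve-∀
  -- Replacing M(M - 1) by 4ab lets all other multiples of N cancel, as 4ab + 4a² = 4aM.
  Mm : 4 * (a * (a + e)) ≡ suc m * m
  Mm = +-cancelʳ-≡ (suc m) _ _ (trans M² (square m))

-- N ≡ 4 modulo e², so the hypothesis forces e² to divide 4(e − 2), which is too small when e > 2.
gap≡2-mod-e² : ∀ N e K w → 4 ≤ e * e → N ≡ 4 + 3 * (e * e) + e * e * (e * e) →
  2 + 2 * w ≡ e * e + e → N * (2 * w) ≡ K * (e * e) → e ≡ 2
gap≡2-mod-e² N 0 K w () _ _ _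
gap≡2-mod-e² N 1 K w (s≤s ()) _ _ _
gap≡2-mod-e² N 2 K w _ _ _ _ = refl
gap≡2-mod-e² N (suc (suc (suc f))) K w _ N≡ w≡ h = contradiction (∣⇒≤ e²∣4g) (<⇒≱ 4g<e²)
  where
  -- In this branch e is at least 3; `g` stands for e - 2, the remainder of 2w modulo `E`.
  e E g : ℕ
  e = 3 + f
  E = e * e
  g = 1 + f
  2w≡ : 2 * w ≡ E + g
  2w≡ = +-cancelˡ-≡ 2 _ _ (trans w≡ (regroup f E))
    where
    regroup : ∀ f E → E + (3 + f) ≡ 2 + (E + (1 + f))
    regroup = solve-∀
  -- Modulo `E`, N is 4 and 2w is `g`, so their product is 4g.
  divisible : E * (4 + (3 + E) * (E + g)) + 4 * g ≡ K * E
  divisible = begin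
    E * (4 + (3 + E) * (E + g)) + 4 * g ≡⟨ expand E g ⟩
    (4 + 3 * E + E * E) * (E + g)       ≡⟨ cong₂ _*_ (sym N≡) (sym 2w≡) ⟩
    N * (2 * w)                         ≡⟨ h ⟩
    K * E                               ∎
    where
    expand : ∀ E g → E * (4 + (3 + E) * (E + g)) + 4 * g ≡ (4 + 3 * E + E * E) * (E + g)
    expand = solve-∀
  e²∣4g : E ∣ 4 * g
  e²∣4g = ∣m+n∣m⇒∣n (divides K divisible) (m∣m*n (4 + (3 + E) * (E + g)))
  -- e² - 4(e - 2) = (e - 2)² + 4, which is 5 + 2f + f² for e = 3 + f.
  4g<e² : 4 * g < E
  4g<e² = subst (4 * g <_) (expand f) (m<m+n (4 * g) {5 + 2 * f + f * f} (s≤s z≤n))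
    where
    expand : ∀ f → 4 * (1 + f) + (5 + 2 * f + f * f) ≡ (3 + f) * (3 + f)
    expand = solve-∀

-- Columns i and j use up two of the b + 1 agreements between the two codewords, whence w = b - 1.
-- Then 2 + 2w = 2b = M + e = e² + e, the form needed for the divisibility argument.
gap≡2 : ∀ {N S₀ S₁ S₁′ G a e m} κ w → let b = a + e; M = a + b in 4 ≤ M → M ≡ suc m →
  S₀ * 2 ^ 2 ≡ N * falling (suc m) 0 → S₁ * 2 ^ 3 ≡ N * falling (suc m) 1 → S₁′ * 2 ^ 3 ≡ N * falling (suc m) 1 →
  G * 2 ^ 4 ≡ N * (2 * w) + N * (suc m * m) →
  G + a * a * S₀ ≡ a * S₁ + (a * S₁′ + e * e * κ) →
  4 * (a * b) + M ≡ M * M → N ≡ 4 + 3 * M + M * M → b ≡ suc w → e ≡ 2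
gap≡2 {N} {S₀} {S₁} {S₁′} {G} {a} {e} {m} κ w M≥4 M≡1+m e₀ e₁ e₁′ eG h M² N≡ b≡ =
  gap≡2-mod-e² N e (16 * κ) w (subst (4 ≤_) M≡ M≥4) (subst (λ M → N ≡ 4 + 3 * M + M * M) M≡ N≡) w≡
    (correlation N S₀ S₁ S₁′ G κ a e m w M≡1+m e₀ e₁ e₁′ eG h (subst (λ M → 4 * (a * (a + e)) + M ≡ M * M) M≡1+m M²))
  where
  M≡ : a + (a + e) ≡ e * e
  M≡ = M≡e² a e M²
  w≡ : 2 + 2 * w ≡ e * e + e
  w≡ = begin
    2 + 2 * w         ≡⟨ double w ⟩
    suc w + suc w     ≡⟨ cong₂ _+_ (sym b≡) (sym b≡) ⟩
    (a + e) + (a + e) ≡⟨ regroup a e ⟩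
    a + (a + e) + e   ≡⟨ cong (_+ e) M≡ ⟩
    e * e + e         ∎
    where
    double : ∀ w → 2 + 2 * w ≡ suc w + suc w
    double = solve-∀
    regroup : ∀ a e → (a + e) + (a + e) ≡ (a + (a + e)) + e
    regroup = solve-∀

-- Codes with two positive numbers of agreements

weighted-+ : (xs : List A) (w f g : A → ℕ) →
  ∑ xs (λ z → w z * (f z + g z)) ≡ ∑ xs (λ z → w z * f z) + ∑ xs (λ z → w z * g z)
weighted-+ xs w f g = trans (∑-cong xs (λ z _ → *-distribˡ-+ (w z) (f z) (g z))) (∑-+ xs _ _)

weighted-* : (xs : List A) (w : A → ℕ) (k : ℕ) (f : A → ℕ) →
  ∑ xs (λ z → w z * (k * f z)) ≡ k * ∑ xs (λ z → w z * f z)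
weighted-* xs w k f = trans (∑-cong xs (λ z _ → swap (w z) k (f z))) (∑-*ˡ xs k _)
  where
  swap : ∀ a b c → a * (b * c) ≡ b * (a * c)
  swap = solve-∀

combine₃ : (xs : List A) (w f g h : A → ℕ) (k : ℕ) →
  ∑ xs (λ z → w z * (f z + (g z + k * h z))) ≡
  ∑ xs (λ z → w z * f z) + (∑ xs (λ z → w z * g z) + k * ∑ xs (λ z → w z * h z))
combine₃ xs w f g h k = trans (weighted-+ xs w f (λ z → g z + k * h z))
  (cong (∑ xs (λ z → w z * f z) +_) (trans (weighted-+ xs w g (λ z → k * h z))
    (cong (∑ xs (λ z → w z * g z) +_) (weighted-* xs w k h))))

-- With b = a + `suc e`, distinct codewords have 1 + a, 1 + b or 0 agreements; the unit stands for
-- one prescribed agreeing column. Writing the gap as `suc e` makes it positive by form.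
module TwoAgreements {n q} (C : Code n q) (design : IsDesign 5 C) (6≤n : 6 ≤ n)
  (N≢0 : NonZero (length (words C))) (2≤q : 2 ≤ q)
  (a e : ℕ) (n≡ : 2 + (a + (a + suc e)) ≡ n)
  (agreements : ∀ {x z} → x ∈ words C → z ∈ words C → x ≢ z →
    agr x [] z ≡ suc (a + suc e) ⊎ agr x [] z ≡ suc a ⊎ agr x [] z ≡ 0) where

  open Design C design 6≤n

  private
    b c M : ℕ
    b = a + suc e
    c = a * b
    M = a + b

  1+n≡ : 1 + suc M ≡ n
  1+n≡ = n≡

  M≥4 : 4 ≤ M
  M≥4 = +-cancelˡ-≤ 2 4 M (subst (6 ≤_) (sym n≡) 6≤n)

  positive-agreement : ∀ {x z} → x ∈ words C → z ∈ words C → x ≢ z → ∀ {w} → agr x [] z ≡ suc w →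
    w ≡ a ⊎ w ≡ b
  positive-agreement x∈ z∈ x≢z eq with agreements x∈ z∈ x≢z
  ... | inj₁ p        = inj₂ (suc-injective (trans (sym eq) p))
  ... | inj₂ (inj₁ p) = inj₁ (suc-injective (trans (sym eq) p))
  ... | inj₂ (inj₂ p) = contradiction (trans (sym eq) p) λ ()

  -- The equation (w - a)(w - b) = 0, with the negative term moved across.
  quadratic : ∀ {w} → w ≡ a ⊎ w ≡ b → w * w + c ≡ M * w
  quadratic (inj₁ refl) = expand a b
    where
    expand : ∀ a b → a * a + a * b ≡ (a + b) * a
    expand = solve-∀
  quadratic (inj₂ refl) = expand a b
    where
    expand : ∀ a b → b * b + a * b ≡ (a + b) * b
    expand = solve-∀

  falling-quadratic : ∀ w → falling w 2 + (falling w 1 + c * falling w 0) ≡ w * w + c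
  falling-quadratic zero = *-identityʳ c
  falling-quadratic (suc w) = expand w c
    where
    expand : ∀ w c → suc w * (w * 1) + (suc w * 1 + c * 1) ≡ suc w * suc w + c
    expand = solve-∀

  quadratic′ : ∀ {w} → w ≡ a ⊎ w ≡ b → falling w 2 + (falling w 1 + c * falling w 0) ≡ M * falling w 1
  quadratic′ {w} h = trans (falling-quadratic w) (trans (quadratic h) (cong (M *_) (sym (*-identityʳ w))))

  -- w times the quadratic, by w³ = w(w - 1)(w - 2) + 3w(w - 1) + w. The values 0 and 1 are treated
  -- separately because `pred` truncates.
  cubic′ : ∀ {w} → w ≡ a ⊎ w ≡ b →
    falling w 3 + (3 * falling w 2 + (falling w 1 + c * falling w 1)) ≡ M * (falling w 2 + falling w 1)
  cubic′ {w} h = trans (left w c) (trans (cong (w *_) (quadratic h)) (right w M))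
    where
    left : ∀ w c → falling w 3 + (3 * falling w 2 + (falling w 1 + c * falling w 1)) ≡ w * (w * w + c)
    left zero c = *-zeroʳ c
    left (suc zero) c = expand c
      where
      expand : ∀ c → 1 + c * 1 ≡ 1 * (1 + c)
      expand = solve-∀
    left (suc (suc w)) c = expand w c
      where
      expand : ∀ w c → (2 + w) * ((1 + w) * (w * 1)) + (3 * ((2 + w) * ((1 + w) * 1)) + ((2 + w) * 1 + c * ((2 + w) * 1)))
        ≡ (2 + w) * ((2 + w) * (2 + w) + c)
      expand = solve-∀
    right : ∀ w M → w * (M * w) ≡ M * (falling w 2 + falling w 1)
    right zero M = sym (*-zeroʳ M)
    right (suc w) M = expand w M
      where
      expand : ∀ w M → suc w * (M * suc w) ≡ M * (suc w * (w * 1) + suc w * 1)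
      expand = solve-∀

  module Single (i : Fin n) {x : Word n q} (x∈ : x ∈ words C) where

    cs : Vec (Fin n) 1
    cs = i ∷ []

    vs : Vec (Fin q) 1
    vs = lookup x i ∷ []

    F : ℕ → Word n q → ℕ
    F r z = falling (agr x cs z) r

    S : ℕ → ℕ
    S r = ∑ (words C) (λ z → χ cs vs z * F r z)

    -- The codeword x has `suc M` agreements with itself outside i; the defect of the quadratic
    -- there is (M + 1)² + c - M(M + 1).
    K : ℕ
    K = suc M + c

    is-x : Word n q → ℕ
    is-x z = ⟦ ≡-dec _≟F_ z x ⟧

    pointwise : ∀ z → z ∈ words C → (∀ k → lookup z (lookup cs k) ≡ lookup vs k) →
      falling (agr x cs z) 2 + (falling (agr x cs z) 1 + c * falling (agr x cs z) 0)
        ≡ M * falling (agr x cs z) 1 + K * is-x z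
    pointwise z z∈ g with ≡-dec _≟F_ z x
    ... | yes refl = subst (λ w → falling w 2 + (falling w 1 + c * falling w 0) ≡ M * falling w 1 + K * 1)
        (suc-injective (trans 1+n≡ (sym (agr-self x cs (refl , tt))))) (expand M c)
      where
      expand : ∀ M c → suc M * (M * 1) + (suc M * 1 + c * 1) ≡ M * (suc M * 1) + (suc M + c) * 1
      expand = solve-∀
    ... | no z≢x = trans (quadratic′ (positive-agreement x∈ z∈ (λ x≡z → z≢x (sym x≡z))
        (trans (agr-remove x [] i z refl) (cong (_+ agr x cs z) (δ-≡ (g 0F))))))
      (sym (trans (cong (M * falling (agr x cs z) 1 +_) (*-zeroʳ K)) (+-identityʳ _)))

    x-once : ∑ (words C) (λ z → χ cs vs z * is-x z) ≡ 1
    x-once = trans (∑-single (unique C) x∈ off) on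
      where
      off : ∀ z → z ∈ words C → z ≢ x → χ cs vs z * is-x z ≡ 0
      off z _ z≢x with ≡-dec _≟F_ z x
      ... | yes z≡x = contradiction z≡x z≢x
      ... | no _ = *-zeroʳ (χ cs vs z)
      on : χ cs vs x * is-x x ≡ 1
      on rewrite δ-≡ {i = lookup x i} refl with ≡-dec _≟F_ x x
      ... | yes _ = refl
      ... | no ¬p = contradiction refl ¬p

    relation : S 2 + (S 1 + c * S 0) ≡ M * S 1 + K
    relation = begin
      S 2 + (S 1 + c * S 0)
        ≡⟨ combine₃ (words C) (χ cs vs) (F 2) (F 1) (F 0) c ⟨
      ∑ (words C) (λ z → χ cs vs z *
        (falling (agr x cs z) 2 + (falling (agr x cs z) 1 + c * falling (agr x cs z) 0)))
        ≡⟨ ∑-cong (words C) (λ z z∈ → χ-cong cs vs z (pointwise z z∈)) ⟩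
      ∑ (words C) (λ z → χ cs vs z * (M * falling (agr x cs z) 1 + K * is-x z))
        ≡⟨ trans (weighted-+ (words C) (χ cs vs) (λ z → M * F 1 z) (λ z → K * is-x z))
             (cong₂ _+_ (weighted-* (words C) (χ cs vs) M (F 1)) (weighted-* (words C) (χ cs vs) K is-x)) ⟩
      M * S 1 + K * ∑ (words C) (λ z → χ cs vs z * is-x z)
        ≡⟨ cong (M * S 1 +_) (trans (cong (K *_) x-once) (*-identityʳ K)) ⟩
      M * S 1 + K ∎

    S-value : ∀ r → r + 1 ≤ 5 → S r * q ^ (r + 1) ≡ N * falling (suc M) r
    S-value r le = moment r cs vs x (suc M) (refl , tt) le 1+n≡

    size : q ≡ 2 → 4 * c + M ≡ M * M → N ≡ 4 + 3 * M + M * M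
    size q≡2 = size-formula N (S 0) (S 1) (S 2) c M
      (value 0 (s≤s z≤n)) (value 1 (s≤s (s≤s z≤n))) (value 2 (s≤s (s≤s (s≤s z≤n)))) relation
      where
      value : ∀ r → r + 1 ≤ 5 → S r * 2 ^ (r + 1) ≡ N * falling (suc M) r
      value r le = subst (λ q → S r * q ^ (r + 1) ≡ N * falling (suc M) r) q≡2 (S-value r le)

  -- The chosen words agree with x in column i and differ from it in column j, so the
  -- distances 0 and n are excluded and only two values of the agreement remain.
  module Pair (i j : Fin n) (distinct : Distinct (i ∷ j ∷ []))
    {x : Word n q} (x∈ : x ∈ words C) (v : Fin q) (v≢ : v ≢ lookup x j) where

    cs : Vec (Fin n) 2
    cs = i ∷ j ∷ []

    vs : Vec (Fin q) 2
    vs = lookup x i ∷ v ∷ []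

    F : Word n q → ℕ → Word n q → ℕ
    F y r z = falling (agr y cs z) r

    S : Word n q → ℕ → ℕ
    S y r = ∑ (words C) (λ z → χ cs vs z * F y r z)

    -- Stated for y and not only for x, since the correlation argument compares z with two codewords
    -- that coincide in columns i and j. Column j makes y and z distinct, column i excludes 0
    -- agreements.
    two-valued : ∀ {y z} → y ∈ words C → lookup y i ≡ lookup x i → lookup y j ≡ lookup x j → z ∈ words C →
      (∀ k → lookup z (lookup cs k) ≡ lookup vs k) → agr y cs z ≡ a ⊎ agr y cs z ≡ b
    two-valued {y} {z} y∈ yi yj z∈ g = positive-agreement y∈ z∈
      (λ { refl → z≢y refl })
      (trans (agr-remove y [] j z refl) (trans
        (cong₂ _+_ (δ-≢ z≢y) (agr-remove y (j ∷ []) i z (proj₁ distinct)))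
        (cong (_+ agr y cs z) (δ-≡ (trans (g 0F) (sym yi))))))
      where
      z≢y : lookup z j ≢ lookup y j
      z≢y eq = v≢ (trans (sym (g 1F)) (trans eq yj))

    S-value : ∀ y r → r + 2 ≤ 5 → S y r * q ^ (r + 2) ≡ N * falling M r
    S-value y r le = moment r cs vs y M distinct le n≡

    first : S x 2 + (S x 1 + c * S x 0) ≡ M * S x 1
    first = begin
      S x 2 + (S x 1 + c * S x 0)
        ≡⟨ combine₃ (words C) (χ cs vs) (F x 2) (F x 1) (F x 0) c ⟨
      ∑ (words C) (λ z → χ cs vs z *
        (falling (agr x cs z) 2 + (falling (agr x cs z) 1 + c * falling (agr x cs z) 0)))
        ≡⟨ ∑-cong (words C) (λ z z∈ → χ-cong cs vs z (λ g → quadratic′ (two-valued x∈ refl refl z∈ g))) ⟩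
      ∑ (words C) (λ z → χ cs vs z * (M * falling (agr x cs z) 1))
        ≡⟨ weighted-* (words C) (χ cs vs) M (F x 1) ⟩
      M * S x 1 ∎

    second : S x 3 + (3 * S x 2 + (S x 1 + c * S x 1)) ≡ M * (S x 2 + S x 1)
    second = begin
      S x 3 + (3 * S x 2 + (S x 1 + c * S x 1))
        ≡⟨ cong (λ t → S x 3 + (t + (S x 1 + c * S x 1))) (weighted-* (words C) (χ cs vs) 3 (F x 2)) ⟨
      S x 3 + (∑ (words C) (λ z → χ cs vs z * (3 * F x 2 z)) + (S x 1 + c * S x 1))
        ≡⟨ cong (S x 3 +_) (combine₃ (words C) (χ cs vs) (λ z → 3 * F x 2 z) (F x 1) (F x 1) c) ⟨
      S x 3 + ∑ (words C) (λ z → χ cs vs z * (3 * F x 2 z + (F x 1 z + c * F x 1 z)))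
        ≡⟨ weighted-+ (words C) (χ cs vs) (F x 3) (λ z → 3 * F x 2 z + (F x 1 z + c * F x 1 z)) ⟨
      ∑ (words C) (λ z → χ cs vs z * (falling (agr x cs z) 3 +
        (3 * falling (agr x cs z) 2 + (falling (agr x cs z) 1 + c * falling (agr x cs z) 1))))
        ≡⟨ ∑-cong (words C) (λ z z∈ → χ-cong cs vs z (λ g → cubic′ (two-valued x∈ refl refl z∈ g))) ⟩
      ∑ (words C) (λ z → χ cs vs z * (M * (falling (agr x cs z) 2 + falling (agr x cs z) 1)))
        ≡⟨ trans (weighted-* (words C) (χ cs vs) M (λ z → F x 2 z + F x 1 z))
             (cong (M *_) (weighted-+ (words C) (χ cs vs) (F x 2) (F x 1))) ⟩
      M * (S x 2 + S x 1) ∎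

    q≡2×M² : q ≡ 2 × 4 * c + M ≡ M * M
    q≡2×M² = conclude M M≥4 (S-value x 0 (s≤s (s≤s z≤n))) (S-value x 1 (s≤s (s≤s (s≤s z≤n))))
        (S-value x 2 (s≤s (s≤s (s≤s (s≤s z≤n))))) (S-value x 3 ≤-refl) first second
      where
      -- M is generalised so that it can be matched as 2 + m.
      conclude : ∀ M → 4 ≤ M →
        S x 0 * q ^ 2 ≡ N * falling M 0 → S x 1 * q ^ 3 ≡ N * falling M 1 →
        S x 2 * q ^ 4 ≡ N * falling M 2 → S x 3 * q ^ 5 ≡ N * falling M 3 →
        S x 2 + (S x 1 + c * S x 0) ≡ M * S x 1 →
        S x 3 + (3 * S x 2 + (S x 1 + c * S x 1)) ≡ M * (S x 2 + S x 1) →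
        q ≡ 2 × 4 * c + M ≡ M * M
      conclude (suc (suc m)) (s≤s (s≤s _)) e₀ e₁ e₂ e₃ h₁ h₂ =
        two-symbols N (S x 0) (S x 1) (S x 2) (S x 3) q c m {{N≢0}} e₀ e₁ e₂ e₃ h₁ h₂ 2≤q

    module _ (y : Word n q) (y∈ : y ∈ words C) (yi : lookup y i ≡ lookup x i) (yj : lookup y j ≡ lookup x j) where

      both-b : Word n q → ℕ
      both-b z = ⟦ agr x cs z ≟ b ⟧ * ⟦ agr y cs z ≟ b ⟧

      G κ : ℕ
      G = ∑ (words C) (λ z → χ cs vs z * (agr y cs z * agr x cs z))
      κ = ∑ (words C) (λ z → χ cs vs z * both-b z)

      -- Mark an agreement of z with y in column l. There z agrees with x exactly if y does, and the
      -- remaining agreements with x form a first moment on three prescribed columns. So y enters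
      -- only through `agr x cs y`.
      G-value : ∀ m → M ≡ suc m → G * q ^ 4 ≡ N * (q * agr x cs y) + N * (suc m * m)
      G-value m M≡ = begin
        G * q ^ 4
          ≡⟨ cong (_* q ^ 4) (mark cs vs y (agr x cs)) ⟩
        ∑ (allFin n) (λ l → new cs l * ∑ (words C) (λ z → χ (l ∷ cs) (lookup y l ∷ vs) z * agr x cs z)) * q ^ 4
          ≡⟨ ∑-*ʳ (allFin n) (q ^ 4) _ ⟨
        ∑ (allFin n) (λ l → new cs l * ∑ (words C) (λ z → χ (l ∷ cs) (lookup y l ∷ vs) z * agr x cs z) * q ^ 4)
          ≡⟨ ∑-cong (allFin n) (λ l _ → trans (*-assoc (new cs l) _ (q ^ 4)) (trans (new-cong cs l (column l))
               (spread (new cs l) (δ (lookup y l) (lookup x l)) N q m))) ⟩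
        ∑ (allFin n) (λ l → N * q * (new cs l * δ (lookup y l) (lookup x l)) + N * m * (new cs l * 1))
          ≡⟨ trans (∑-+ (allFin n) (λ l → N * q * (new cs l * δ (lookup y l) (lookup x l))) (λ l → N * m * (new cs l * 1)))
               (cong₂ _+_ (∑-*ˡ (allFin n) (N * q) (λ l → new cs l * δ (lookup y l) (lookup x l)))
                          (∑-*ˡ (allFin n) (N * m) (λ l → new cs l * 1))) ⟩
        N * q * agr x cs y + N * m * ∑ (allFin n) (λ l → new cs l * 1)
          ≡⟨ cong (λ t → N * q * agr x cs y + N * m * t)
               (+-cancelˡ-≡ 2 _ _ (trans (∑-new cs distinct) (trans (sym n≡) (cong (2 +_) M≡)))) ⟩
        N * q * agr x cs y + N * m * suc m
          ≡⟨ tidy N q (agr x cs y) m ⟩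
        N * (q * agr x cs y) + N * (suc m * m) ∎
        where
        spread : ∀ u d N q m → u * (q * d * N + N * (m * 1)) ≡ N * q * (u * d) + N * m * (u * 1)
        spread = solve-∀
        tidy : ∀ N q w m → N * q * w + N * m * suc m ≡ N * (q * w) + N * (suc m * m)
        tidy = solve-∀
        gather : ∀ d P Q q → (d * P + Q) * (q * (q * (q * (q * 1)))) ≡
          q * d * (P * (q * (q * (q * 1)))) + Q * (q * (q * (q * (q * 1))))
        gather = solve-∀
        column : ∀ l → new cs l ≡ 1 →
          ∑ (words C) (λ z → χ (l ∷ cs) (lookup y l ∷ vs) z * agr x cs z) * q ^ 4 ≡
          q * δ (lookup y l) (lookup x l) * N + N * (m * 1)
        column l h = begin
          ∑ (words C) (λ z → χ cs′ vs′ z * agr x cs z) * q ^ 4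
            ≡⟨ cong (_* q ^ 4) (∑-cong (words C) (λ z _ → χ-cong cs′ vs′ z (λ g →
                 trans (agr-remove x cs l z h) (cong₂ _+_
                   (trans (cong (λ s → δ s (lookup x l)) (g 0F)) (sym (*-identityʳ _)))
                   (sym (*-identityʳ _)))))) ⟩
          ∑ (words C) (λ z → χ cs′ vs′ z * (δ (lookup y l) (lookup x l) * 1 + falling (agr x cs′ z) 1)) * q ^ 4
            ≡⟨ cong (_* q ^ 4) (trans (weighted-+ (words C) (χ cs′ vs′) (λ _ → δ (lookup y l) (lookup x l) * 1)
                     (λ z → falling (agr x cs′ z) 1))
                 (cong (_+ ∑ (words C) (λ z → χ cs′ vs′ z * falling (agr x cs′ z) 1))
                   (weighted-* (words C) (χ cs′ vs′) (δ (lookup y l) (lookup x l)) (λ _ → 1)))) ⟩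
          (δ (lookup y l) (lookup x l) * ∑ (words C) (λ z → χ cs′ vs′ z * 1)
            + ∑ (words C) (λ z → χ cs′ vs′ z * falling (agr x cs′ z) 1)) * q ^ 4
            ≡⟨ gather (δ (lookup y l) (lookup x l)) (∑ (words C) (λ z → χ cs′ vs′ z * 1))
                 (∑ (words C) (λ z → χ cs′ vs′ z * falling (agr x cs′ z) 1)) q ⟩
          q * δ (lookup y l) (lookup x l) * (∑ (words C) (λ z → χ cs′ vs′ z * 1) * q ^ 3)
            + ∑ (words C) (λ z → χ cs′ vs′ z * falling (agr x cs′ z) 1) * q ^ 4
            ≡⟨ cong₂ (λ s t → q * δ (lookup y l) (lookup x l) * s + t)
                 (trans (moment 0 cs′ vs′ x m (h , distinct) (s≤s (s≤s (s≤s z≤n))) 3+m≡) (*-identityʳ N))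
                 (moment 1 cs′ vs′ x m (h , distinct) (s≤s (s≤s (s≤s (s≤s z≤n)))) 3+m≡) ⟩
          q * δ (lookup y l) (lookup x l) * N + N * (m * 1) ∎
          where
          cs′ : Vec (Fin n) 3
          cs′ = l ∷ cs
          vs′ : Vec (Fin q) 3
          vs′ = lookup y l ∷ vs
          3+m≡ : 3 + m ≡ n
          3+m≡ = trans (cong (2 +_) (sym M≡)) n≡

      -- The product (s - a)(t - a) is zero unless both numbers are b, and then it is the square of
      -- the gap `suc e`.
      product-of-agreements : ∀ {s t} → s ≡ a ⊎ s ≡ b → t ≡ a ⊎ t ≡ b →
        t * s + a * a * 1 ≡ a * falling s 1 + (a * falling t 1 + suc e * suc e * (⟦ s ≟ b ⟧ * ⟦ t ≟ b ⟧))
      product-of-agreements {s} {t} hs ht with s ≟ b | t ≟ b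
      ... | yes refl | yes refl = expand a (suc e)
        where
        expand : ∀ a e → (a + e) * (a + e) + a * a * 1 ≡ a * ((a + e) * 1) + (a * ((a + e) * 1) + e * e * 1)
        expand = solve-∀
      product-of-agreements {s} {t} hs (inj₂ t≡b) | _ | no t≢b = contradiction t≡b t≢b
      product-of-agreements {s} {t} hs (inj₁ refl) | d | no _ rewrite *-zeroʳ ⟦ d ⟧ = expand t s (suc e)
        where
        expand : ∀ t s e → t * s + t * t * 1 ≡ t * (s * 1) + (t * (t * 1) + e * e * 0)
        expand = solve-∀
      product-of-agreements {s} {t} (inj₂ s≡b) ht | no s≢b | yes _ = contradiction s≡b s≢b
      product-of-agreements {s} {t} (inj₁ refl) ht | no _ | yes _ = expand s t (suc e)
        where
        expand : ∀ s t e → t * s + s * s * 1 ≡ s * (s * 1) + (s * (t * 1) + e * e * 0)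
        expand = solve-∀

      G-κ : G + a * a * S x 0 ≡ a * S x 1 + (a * S y 1 + suc e * suc e * κ)
      G-κ = begin
        G + a * a * S x 0
          ≡⟨ trans (weighted-+ (words C) (χ cs vs) (λ z → agr y cs z * agr x cs z) (λ z → a * a * F x 0 z))
               (cong (G +_) (weighted-* (words C) (χ cs vs) (a * a) (F x 0))) ⟨
        ∑ (words C) (λ z → χ cs vs z * (agr y cs z * agr x cs z + a * a * 1))
          ≡⟨ ∑-cong (words C) (λ z z∈ → χ-cong cs vs z (λ g →
               product-of-agreements (two-valued x∈ refl refl z∈ g) (two-valued y∈ yi yj z∈ g))) ⟩
        ∑ (words C) (λ z → χ cs vs z * (a * falling (agr x cs z) 1 + (a * falling (agr y cs z) 1
          + suc e * suc e * (⟦ agr x cs z ≟ b ⟧ * ⟦ agr y cs z ≟ b ⟧))))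
          ≡⟨ combine₃ (words C) (χ cs vs) (λ z → a * F x 1 z) (λ z → a * F y 1 z) both-b (suc e * suc e) ⟩
        ∑ (words C) (λ z → χ cs vs z * (a * F x 1 z)) +
          (∑ (words C) (λ z → χ cs vs z * (a * F y 1 z)) + suc e * suc e * κ)
          ≡⟨ cong₂ (λ s t → s + (t + suc e * suc e * κ))
               (weighted-* (words C) (χ cs vs) a (F x 1)) (weighted-* (words C) (χ cs vs) a (F y 1)) ⟩
        a * S x 1 + (a * S y 1 + suc e * suc e * κ) ∎

      gap : b ≡ suc (agr x cs y) → suc e ≡ 2
      gap b≡ = gap≡2 κ (agr x cs y) M≥4 M≡1+m
        (value x 0 (s≤s (s≤s z≤n))) (value x 1 (s≤s (s≤s (s≤s z≤n)))) (value y 1 (s≤s (s≤s (s≤s z≤n))))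
        (subst (λ q → G * q ^ 4 ≡ N * (q * agr x cs y) + N * (suc m * m)) q≡2 (G-value m M≡1+m))
        G-κ M² (Single.size i x∈ q≡2 M²) b≡
        where
        q≡2 : q ≡ 2
        q≡2 = proj₁ q≡2×M²
        M² : 4 * c + M ≡ M * M
        M² = proj₂ q≡2×M²
        m : ℕ
        m = pred M
        M≡1+m : M ≡ suc m
        M≡1+m = sym (suc-pred M {{>-nonZero (≤-trans (s≤s z≤n) M≥4)}})
        value : ∀ y r → r + 2 ≤ 5 → S y r * 2 ^ (r + 2) ≡ N * falling (suc m) r
        value y r le = subst₂ (λ q M → S y r * q ^ (r + 2) ≡ N * falling M r) q≡2 M≡1+m (S-value y r le)

  -- A second agreement remains after the first is removed, because b exceeds a and is thus
  -- positive.
  common-columns : (x y : Word n q) → agr x [] y ≡ suc b →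
    ∃ λ i → ∃ λ j → Distinct (i ∷ j ∷ []) × lookup y i ≡ lookup x i × lookup y j ≡ lookup x j
      × agr x [] y ≡ 2 + agr x (i ∷ j ∷ []) y
  common-columns x y eq = i , j , (i-new , refl , tt) , yi , yj , (begin
      agr x [] y                  ≡⟨ remove-j ⟩
      suc (agr x (j ∷ []) y)      ≡⟨ cong suc (agr-remove x (j ∷ []) i y i-new) ⟩
      suc (δ (lookup y i) (lookup x i) + agr x (i ∷ j ∷ []) y)
                                  ≡⟨ cong (λ t → suc (t + agr x (i ∷ j ∷ []) y)) (δ-≡ yi) ⟩
      2 + agr x (i ∷ j ∷ []) y    ∎)
    where
    agreeing : ∀ {k} (cs : Vec (Fin n) k) → 0 < agr x cs y → ∃ λ l → new cs l ≡ 1 × lookup y l ≡ lookup x l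
    agreeing cs pos with ∑-positive (allFin n) (λ l → new cs l * δ (lookup y l) (lookup x l)) pos
    ... | l , _ , p with new-0∨1 cs l | lookup y l ≟F lookup x l
    ...   | inj₁ h | d = contradiction (subst (λ u → 0 < u * ⟦ d ⟧) h p) λ ()
    ...   | inj₂ h | yes yl = l , h , yl
    ...   | inj₂ h | no _ = contradiction (subst (0 <_) (*-zeroʳ (new cs l)) p) λ ()
    found-j : ∃ λ j → 1 ≡ 1 × lookup y j ≡ lookup x j
    found-j = agreeing [] (subst (0 <_) (sym eq) (s≤s z≤n))
    j : Fin n
    j = proj₁ found-j
    yj : lookup y j ≡ lookup x j
    yj = proj₂ (proj₂ found-j)
    remove-j : agr x [] y ≡ suc (agr x (j ∷ []) y)
    remove-j = trans (agr-remove x [] j y refl) (cong (_+ agr x (j ∷ []) y) (δ-≡ yj))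
    found-i : ∃ λ i → new (j ∷ []) i ≡ 1 × lookup y i ≡ lookup x i
    found-i = agreeing (j ∷ []) (subst (0 <_) (suc-injective (trans (sym eq) remove-j))
      (subst (0 <_) (sym (+-suc a e)) (s≤s z≤n)))
    i : Fin n
    i = proj₁ found-i
    i-new : new (j ∷ []) i ≡ 1
    i-new = proj₁ (proj₂ found-i)
    yi : lookup y i ≡ lookup x i
    yi = proj₂ (proj₂ found-i)

  other-symbol : (s : Fin q) → ∃ λ v → v ≢ s
  other-symbol s = go q 2≤q s
    where
    go : ∀ q → 2 ≤ q → (s : Fin q) → ∃ λ v → v ≢ s
    go (suc (suc _)) (s≤s (s≤s _)) zero    = 1F , λ ()
    go (suc (suc _)) (s≤s (s≤s _)) (suc s) = 0F , λ ()

  -- Two codewords with 1 + b agreements supply the columns i and j. The values of q and M = e² come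
  -- from x alone, and e = 2 from the comparison with y.
  parameters : {x y : Word n q} → x ∈ words C → y ∈ words C → agr x [] y ≡ suc b → q ≡ 2 × suc e ≡ 2 × M ≡ 4
  parameters {x} {y} x∈ y∈ eq =
    let i , j , distinct , yi , yj , w≡ = common-columns x y eq
        v , v≢ = other-symbol (lookup x j)
        open Pair i j distinct x∈ v v≢
        e≡2 = gap y y∈ yi yj (suc-injective (trans (sym eq) w≡))
    in proj₁ q≡2×M² , e≡2 , trans (M≡e² a (suc e) (proj₂ q≡2×M²)) (cong (λ t → t * t) e≡2)

-- Binary words, translation and parity

xor : Fin 2 → Fin 2 → Fin 2
xor 0F t  = t
xor 1F 0F = 1F
xor 1F 1F = 0F

xor-involutive : ∀ s t → xor s (xor s t) ≡ t
xor-involutive 0F t  = refl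
xor-involutive 1F 0F = refl
xor-involutive 1F 1F = refl

δ̄-xor : ∀ s t → δ̄ (xor s t) 0F ≡ δ̄ s t
δ̄-xor 0F 0F = refl
δ̄-xor 0F 1F = refl
δ̄-xor 1F 0F = refl
δ̄-xor 1F 1F = refl

_⊕_ : ∀ {n} → Word n 2 → Word n 2 → Word n 2
x ⊕ z = tabulate (λ i → xor (lookup x i) (lookup z i))

weight-⊕ : ∀ {n} (x z : Word n 2) → weight (x ⊕ z) ≡ hamming x z
weight-⊕ {n} x z = begin
  weight (x ⊕ z)
    ≡⟨ length-filter-∑ _ (allFin n) ⟩
  ∑ (allFin n) (λ i → δ̄ (lookup (x ⊕ z) i) 0F)
    ≡⟨ ∑-cong (allFin n) (λ i _ → trans (cong (λ s → δ̄ s 0F) (lookup∘tabulate _ i))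
         (δ̄-xor (lookup x i) (lookup z i))) ⟩
  ∑ (allFin n) (λ i → δ̄ (lookup x i) (lookup z i))
    ≡⟨ length-filter-∑ _ (allFin n) ⟨
  hamming x z ∎

lookup-extensional : ∀ {n} {y z : Vec A n} → (∀ i → lookup y i ≡ lookup z i) → y ≡ z
lookup-extensional {y = y} {z} h = trans (sym (tabulate∘lookup y)) (trans (tabulate-cong h) (tabulate∘lookup z))

-- Parity recovers the one symbol that the other columns leave open.
even-determined : ∀ {n} (i : Fin n) (y z : Word n 2) → 2 ∣ weight y → 2 ∣ weight z →
  (∀ l → i ≢ l → lookup y l ≡ lookup z l) → y ≡ z
even-determined {n} i y z 2∣y 2∣z h = lookup-extensional same
  where
  rest : Word n 2 → ℕ
  rest y = ∑ (allFin n) (λ l → δ̄ i l * δ̄ (lookup y l) 0F)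
  weight≡ : ∀ y → weight y ≡ δ̄ (lookup y i) 0F + rest y
  weight≡ y = trans (length-filter-∑ _ (allFin n)) (∑-remove i (λ l → δ̄ (lookup y l) 0F))
  rest≡ : rest y ≡ rest z
  rest≡ = ∑-cong (allFin n) (λ l _ → pointwise l)
    where
    pointwise : ∀ l → δ̄ i l * δ̄ (lookup y l) 0F ≡ δ̄ i l * δ̄ (lookup z l) 0F
    pointwise l with i ≟F l
    ... | yes _  = refl
    ... | no i≢l = cong (λ s → δ̄ s 0F + 0) (h l i≢l)
  odd≢even : ∀ {R} → 2 ∣ R → ¬ 2 ∣ 1 + R
  odd≢even {R} p q = contradiction (∣⇒≤ (∣m+n∣m⇒∣n (subst (2 ∣_) (+-comm 1 R) q) p)) λ { (s≤s ()) }
  same-parity : ∀ (s t : Fin 2) {R} → 2 ∣ δ̄ s 0F + R → 2 ∣ δ̄ t 0F + R → s ≡ t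
  same-parity 0F 0F _ _ = refl
  same-parity 0F 1F p q = contradiction q (odd≢even p)
  same-parity 1F 0F p q = contradiction p (odd≢even q)
  same-parity 1F 1F _ _ = refl
  same : ∀ l → lookup y l ≡ lookup z l
  same l with i ≟F l
  ... | no i≢l   = h l i≢l
  ... | yes refl = same-parity (lookup y i) (lookup z i) (subst (2 ∣_) (weight≡ y) 2∣y)
    (subst (2 ∣_) (trans (weight≡ z) (cong (δ̄ (lookup z i) 0F +_) (sym rest≡))) 2∣z)

∈⇒nonempty : {xs : List A} {x : A} → x ∈ xs → NonZero (length xs)
∈⇒nonempty (here _)  = _
∈⇒nonempty (there _) = _

hamming-self : ∀ {n q} (x : Word n q) → hamming x x ≡ 0
hamming-self {n} x = +-cancelʳ-≡ n _ _
  (trans (cong (hamming x x +_) (sym (agr-self x [] tt))) (hamming+agr x x))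

⊕-even : ∀ {n} (C : Code n 2) → (∀ {x z} → x ∈ words C → z ∈ words C → x ≢ z → 2 ∣ hamming x z) →
  ∀ {x z} → x ∈ words C → z ∈ words C → 2 ∣ weight (x ⊕ z)
⊕-even C even {x} {z} x∈ z∈ = subst (2 ∣_) (sym (weight-⊕ x z)) (by-cases (≡-dec _≟F_ x z))
  where
  by-cases : Dec (x ≡ z) → 2 ∣ hamming x z
  by-cases (yes refl) = subst (2 ∣_) (sym (hamming-self x)) (2 ∣0)
  by-cases (no x≢z)   = even x∈ z∈ x≢z

⊕-cancel : ∀ {n} (w x y : Word n 2) l → lookup x l ≡ lookup (w ⊕ y) l → lookup (w ⊕ x) l ≡ lookup y l
⊕-cancel w x y l h = begin
  lookup (w ⊕ x) l                                 ≡⟨ lookup∘tabulate _ l ⟩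
  xor (lookup w l) (lookup x l)                    ≡⟨ cong (xor (lookup w l)) h ⟩
  xor (lookup w l) (lookup (w ⊕ y) l)              ≡⟨ cong (xor (lookup w l)) (lookup∘tabulate _ l) ⟩
  xor (lookup w l) (xor (lookup w l) (lookup y l)) ≡⟨ xor-involutive (lookup w l) (lookup y l) ⟩
  lookup y l                                       ∎

-- Translation by a codeword `x₀` turns distances to `x₀` into weights, so all become even.
-- Conversely, strength 5 realises any symbols in the first five columns, and parity fixes the
-- sixth.
even-code : (C : Code 6 2) → IsDesign 5 C → ∀ {x₀} → x₀ ∈ words C →
  (∀ {x z} → x ∈ words C → z ∈ words C → x ≢ z → 2 ∣ hamming x z) → IsomorphicTo C EvenWeight6
even-code C design {x₀} x₀∈ even = ↔-id _ , translate , λ y → cover y , λ { (x , x∈ , refl) → ⊕-even C even x₀∈ x∈ }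
  where
  translate : (i : Fin 6) → Fin 2 ↔ Fin 2
  translate i = mk↔ₛ′ (xor (lookup x₀ i)) (xor (lookup x₀ i))
    (xor-involutive (lookup x₀ i)) (xor-involutive (lookup x₀ i))

  cs : Vec (Fin 6) 5
  cs = 0F ∷ 1F ∷ 2F ∷ 3F ∷ 4F ∷ []

  cover : ∀ y → EvenWeight6 y → Σ (Word 6 2) λ x → x ∈ words C × x₀ ⊕ x ≡ y
  cover y 2∣y = x , x∈ , even-determined 5F (x₀ ⊕ x) y (⊕-even C even x₀∈ x∈) 2∣y same
    where
    -- The pattern comes from `x₀ ⊕ y` because translating by `x₀` once more returns y.
    found : ∃ λ x → x ∈ words C × (∀ k → lookup x (lookup cs k) ≡ lookup (restrict (lookup cs) (x₀ ⊕ y)) k)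
    found = Design.covered C design ≤-refl (∈⇒nonempty x₀∈) ≤-refl cs
      (refl , refl , refl , refl , refl , tt) (restrict (lookup cs) (x₀ ⊕ y))
    x : Word 6 2
    x = proj₁ found
    x∈ : x ∈ words C
    x∈ = proj₁ (proj₂ found)
    listed : ∀ k → lookup (x₀ ⊕ x) (lookup cs k) ≡ lookup y (lookup cs k)
    listed k = ⊕-cancel x₀ x y (lookup cs k) (trans (proj₂ (proj₂ found) k)
      (lookup∘tabulate (λ j → lookup (x₀ ⊕ y) (lookup cs j)) k))
    same : ∀ l → 5F ≢ l → lookup (x₀ ⊕ x) l ≡ lookup y l
    same 0F _ = listed 0F
    same 1F _ = listed 1F
    same 2F _ = listed 2F
    same 3F _ = listed 3F
    same 4F _ = listed 4F
    same 5F p = contradiction refl p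

-- From the degree set to numbers of agreements

agr-from-hamming : ∀ {n q} (x z : Word n q) {d k} → hamming x z ≡ d → d + k ≡ n → agr x [] z ≡ k
agr-from-hamming x z {d} h d+k≡n = +-cancelˡ-≡ d _ _
  (trans (cong (_+ agr x [] z) (sym h)) (trans (hamming+agr x z) (sym d+k≡n)))

theorem4p12 : (n q : ℕ) → 6 ≤ n → 2 ≤ q → (C : Code n q) → words C ≢ [] →
    IsDesign 5 C → (a : ℕ) → 2 * a < n →
    a ≢ n ∸ a → a ≢ n → n ∸ a ≢ n →
    (∀ d → InDegreeSet C d ⇔ (d ≡ a ⊎ d ≡ n ∸ a ⊎ d ≡ n)) →
    IsomorphicTo C EvenWeight6
-- For a = 0 the distances n - a and n would coincide.
theorem4p12 n q 6≤n 2≤q C nonempty design zero 2a<n _ _ n∸a≢n degrees = contradiction refl n∸a≢n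
-- From here `a` is one less than the smallest distance, and `suc e` is n - 2(a + 1), positive by
-- `2a<n`.
theorem4p12 n q 6≤n 2≤q C nonempty design (suc a) 2a<n _ _ _ degrees
  with e , 2a+e≡n ← m≤n⇒∃[o]m+o≡n 2a<n = conclude (Equivalence.from (degrees (suc a)) (inj₁ refl))
  where
  n≡ : 2 + (a + (a + suc e)) ≡ n
  n≡ = trans (regroup a e) 2a+e≡n
    where
    regroup : ∀ a e → 2 + (a + (a + suc e)) ≡ suc (2 * suc a) + e
    regroup = solve-∀
  split-n : suc a + suc (a + suc e) ≡ n
  split-n = trans (+-suc (suc a) _) n≡
  n∸a≡ : n ∸ suc a ≡ suc (a + suc e)
  n∸a≡ = trans (cong (_∸ suc a) (sym split-n)) (m+n∸m≡n (suc a) _)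
  distances : ∀ {x z} → x ∈ words C → z ∈ words C → x ≢ z →
    hamming x z ≡ suc a ⊎ hamming x z ≡ n ∸ suc a ⊎ hamming x z ≡ n
  distances x∈ z∈ x≢z = Equivalence.to (degrees _) (_ , _ , x∈ , z∈ , x≢z , refl)
  -- Distance d means n - d agreements, so the smallest distance carries the largest number.
  agreements : ∀ {x z} → x ∈ words C → z ∈ words C → x ≢ z →
    agr x [] z ≡ suc (a + suc e) ⊎ agr x [] z ≡ suc a ⊎ agr x [] z ≡ 0
  agreements {x} {z} x∈ z∈ x≢z with distances x∈ z∈ x≢z
  ... | inj₁ h        = inj₁ (agr-from-hamming x z h split-n)
  ... | inj₂ (inj₁ h) = inj₂ (inj₁ (agr-from-hamming x z (trans h n∸a≡) (trans (+-comm (suc (a + suc e)) (suc a)) split-n)))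
  ... | inj₂ (inj₂ h) = inj₂ (inj₂ (agr-from-hamming x z h (+-identityʳ n)))
  -- Stated for arbitrary n and q so that both equations can be matched with `refl`.
  specialise : ∀ {n q} (C : Code n q) → n ≡ 6 → q ≡ 2 → IsDesign 5 C → ∀ {x} → x ∈ words C →
    (∀ {x z} → x ∈ words C → z ∈ words C → x ≢ z → 2 ∣ hamming x z) → IsomorphicTo C EvenWeight6
  specialise C refl refl design x∈ even = even-code C design x∈ even
  even : n ≡ 6 → suc e ≡ 2 → a + (a + suc e) ≡ 4 → ∀ {x z} → x ∈ words C → z ∈ words C → x ≢ z → 2 ∣ hamming x z
  even n≡6 e≡2 M≡4 x∈ z∈ x≢z = by-cases (distances x∈ z∈ x≢z)
    where
    -- From 2a + 2 = 4; the three distances are then 2, 4 and 6.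
    a≡1 : a ≡ 1
    a≡1 = *-cancelˡ-≡ a 1 2 (+-cancelʳ-≡ 2 _ _ (trans (regroup a 2)
      (trans (cong (λ t → a + (a + t)) (sym e≡2)) M≡4)))
      where
      regroup : ∀ a e → 2 * a + e ≡ a + (a + e)
      regroup = solve-∀
    by-cases : ∀ {d} → d ≡ suc a ⊎ d ≡ n ∸ suc a ⊎ d ≡ n → 2 ∣ d
    by-cases (inj₁ h)        = divides 1 (trans h (cong suc a≡1))
    by-cases (inj₂ (inj₁ h)) = divides 2 (trans h (cong₂ _∸_ n≡6 (cong suc a≡1)))
    by-cases (inj₂ (inj₂ h)) = divides 3 (trans h n≡6)
  conclude : InDegreeSet C (suc a) → IsomorphicTo C EvenWeight6
  -- Codewords at distance `suc a` have 1 + b agreements, as `parameters` requires.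
  conclude (x , y , x∈ , y∈ , _ , h) =
    let q≡2 , e≡2 , M≡4 =
          TwoAgreements.parameters C design 6≤n (∈⇒nonempty x∈) 2≤q a e n≡ agreements x∈ y∈
            (agr-from-hamming x y h split-n)
        n≡6 = trans (sym n≡) (cong (2 +_) M≡4)
    in specialise C n≡6 q≡2 design x∈ (even n≡6 e≡2 M≡4)
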